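{- For every sufficiently small $\varepsilon\in(0,1)$ and every integer $r\ge 1/\varepsilon^5$, the following holds: for all sufficiently large $n$, there is a balanced $r$-colouring of the edges of $K_n$ such that, in every copy in $K_n$ of a $\lceil 1/\varepsilon\rceil$-caterpillar on $n$ vertices, the number of edges in colour $1$ is smaller than the number of edges in one of the colours $2,\dots,r$.
   Context: An $r$-colouring is an edge-colouring with colours in $\{1,\dots,r\}$. It is balanced if the numbers of edges in any two different colours differ by at most $1$. For an integer $\ell\ge 1$, an $\ell$-caterpillar is a tree in which every vertex lies within distance $1$ of a central path of length $\ell$ (that is, with $\ell$ edges and $\ell+1$ vertices), and the degrees of the vertices in this central path differ by at most $1$. A copy of a graph in $K_n$ is a subgraph of $K_n$ isomorphic to it. "Sufficiently large $n$" may depend on $\varepsilon$ and $r$. -}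

module Defs where

open import Data.Fin.Base using (Fin; zero; suc; inject₁; fromℕ)
open import Data.Fin.Properties using (_≟_; _<?_)
open import Data.Fin.Subset using (Subset; _∈_)
open import Data.Integer.Base using (+_)
open import Data.List.Base using (List; allFin; cartesianProduct; filter; length)
open import Data.Nat.Base as ℕ using (ℕ; zero; suc)
import Data.Nat.Properties as ℕ
open import Data.Product using (∃-syntax; _×_; _,_)
open import Data.Rational.Base as ℚ using (ℚ; 0ℚ; 1ℚ)
import Data.Rational.Properties as ℚ
open import Function.Bundles using (_⇔_)
open import Function.Definitions using (Injective)
open import Level using (0ℓ)
open import Relation.Binary.Core using (Rel)
open import Relation.Binary.Definitions using (Decidable; Irreflexive; Symmetric; tri<; tri≈; tri>)
open import Relation.Binary.PropositionalEquality
open import Relation.Nullary.Decidable using (¬?; _×-dec_)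
open import Relation.Nullary.Negation using (¬_)

-- A positive real is a Dedekind cut in the positive rationals, given by its
-- lower part  Below q  (0 < q < x), with no decidability or locatedness
-- assumed; classically these are exactly the positive reals.
record ℝ⁺ : Set₁ where
  field
    Below     : ℚ → Set
    positive  : ∀ {q} → Below q → 0ℚ ℚ.< q
    inhabited : ∃[ q ] Below q
    bounded   : ∃[ q ] (0ℚ ℚ.< q × ¬ Below q)
    downward  : ∀ {p q} → 0ℚ ℚ.< p → p ℚ.< q → Below q → Below p
    open-up   : ∀ {p} → Below p → ∃[ q ] (p ℚ.< q × Below q)

open ℝ⁺ public using (Below)

-- q separates the two cuts:  x ≤ q < y.
infix 4 _<ᵣ_ _≤ℕ_
_<ᵣ_ : Rel ℝ⁺ 0ℓ
x <ᵣ y = ∃[ q ] (¬ Below x q × Below y q)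

-- Lower parts are open, so  x ≤ m  iff every q in the lower part of x is < m.
_≤ℕ_ : ℝ⁺ → ℕ → Set
x ≤ℕ m = ∀ {q} → Below x q → q ℚ.< + m ℚ./ 1

private
  0<1 : 0ℚ ℚ.< 1ℚ
  0<1 = ℚ.positive⁻¹ 1ℚ

  0<* : ∀ {p q} → 0ℚ ℚ.< p → 0ℚ ℚ.< q → 0ℚ ℚ.< p ℚ.* q
  0<* {p} {q} 0<p 0<q =
    ℚ.positive⁻¹ _ {{ℚ.pos*pos⇒pos p {{ℚ.positive 0<p}} q {{ℚ.positive 0<q}}}}

  *-mono-< : ∀ {p q s t} → 0ℚ ℚ.< q → 0ℚ ℚ.< s → p ℚ.< q → s ℚ.< t →
             p ℚ.* s ℚ.< q ℚ.* t
  *-mono-< {q = q} {s = s} 0<q 0<s p<q s<t = ℚ.<-trans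
    (ℚ.*-monoˡ-<-pos s {{ℚ.positive 0<s}} p<q)
    (ℚ.*-monoʳ-<-pos q {{ℚ.positive 0<q}} s<t)

  inverse : ∀ {s} → 0ℚ ℚ.< s → ∃[ t ] (0ℚ ℚ.< t × t ℚ.* s ≡ 1ℚ)
  inverse {s} 0<s = ℚ.1/ s , ℚ.positive⁻¹ _ {{ℚ.1/pos⇒pos s}} , ℚ.*-inverseˡ s
    where instance
      s-pos : ℚ.Positive s
      s-pos = ℚ.positive 0<s
      s-nz : ℚ.NonZero s
      s-nz = ℚ.pos⇒nonZero s

  below<above : ∀ (x : ℝ⁺) {a s} → Below x a → 0ℚ ℚ.< s → ¬ Below x s → a ℚ.< s
  below<above x {a} {s} xa 0<s ¬xs with ℚ.<-cmp a s
  ... | tri< a<s _ _ = a<s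
  ... | tri≈ _ refl _ with () ← ¬xs xa
  ... | tri> _ _ s<a with () ← ¬xs (ℝ⁺.downward x 0<s s<a xa)

  raise : ∀ {q s} → 0ℚ ℚ.< s → q ℚ.* s ℚ.< 1ℚ → ∃[ p ] (q ℚ.< p × p ℚ.* s ℚ.< 1ℚ)
  raise {q} {s} 0<s qs<1 with ℚ.<-dense qs<1 | inverse 0<s
  ... | t , qs<t , t<1 | i , _ , is≡1 =
    t ℚ.* i , ℚ.*-cancelʳ-<-pos s (ℚ.positive 0<s) (subst (q ℚ.* s ℚ.<_) (sym eq) qs<t)
            , subst (ℚ._< 1ℚ) (sym eq) t<1
    where
    eq : t ℚ.* i ℚ.* s ≡ t
    eq = trans (ℚ.*-assoc t i s) (trans (cong (t ℚ.*_) is≡1) (ℚ.*-identityʳ t))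

1ᵣ : ℝ⁺
1ᵣ = record
  { Below     = λ q → 0ℚ ℚ.< q × q ℚ.< 1ℚ
  ; positive  = λ (0<q , _) → 0<q
  ; inhabited = ℚ.<-dense 0<1
  ; bounded   = 1ℚ , 0<1 , λ (_ , 1<1) → ℚ.<-irrefl refl 1<1
  ; downward  = λ 0<p p<q (_ , q<1) → 0<p , ℚ.<-trans p<q q<1
  ; open-up   = λ (0<p , p<1) → let q , p<q , q<1 = ℚ.<-dense p<1
                                in q , p<q , ℚ.<-trans 0<p p<q , q<1
  }

infixl 7 _*ᵣ_
_*ᵣ_ : ℝ⁺ → ℝ⁺ → ℝ⁺
x *ᵣ y = record
  { Below     = λ q → 0ℚ ℚ.< q × ∃[ a ] ∃[ b ] (Below x a × Below y b × q ℚ.< a ℚ.* b)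
  ; positive  = λ (0<q , _) → 0<q
  ; inhabited = let a , xa = X.inhabited
                    b , yb = Y.inhabited
                    q , 0<q , q<ab = ℚ.<-dense (0<* (X.positive xa) (Y.positive yb))
                in q , 0<q , a , b , xa , yb , q<ab
  ; bounded   = let s , 0<s , ¬xs = X.bounded
                    t , 0<t , ¬yt = Y.bounded
                in s ℚ.* t , 0<* 0<s 0<t , λ (_ , a , b , xa , yb , st<ab) →
                   ℚ.<-asym st<ab
                     (*-mono-< 0<s (Y.positive yb) (below<above x xa 0<s ¬xs)
                                                   (below<above y yb 0<t ¬yt))
  ; downward  = λ 0<p p<q (_ , a , b , xa , yb , q<ab) →
                  0<p , a , b , xa , yb , ℚ.<-trans p<q q<ab
  ; open-up   = λ (0<p , a , b , xa , yb , p<ab) →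
                  let q , p<q , q<ab = ℚ.<-dense p<ab
                  in q , p<q , ℚ.<-trans 0<p p<q , a , b , xa , yb , q<ab
  }
  where
  module X = ℝ⁺ x
  module Y = ℝ⁺ y

-- q < 1/x  iff  q < 1/s  for some positive rational s ≥ x.
infix 8 1/ᵣ_
1/ᵣ_ : ℝ⁺ → ℝ⁺
1/ᵣ x = record
  { Below     = λ q → 0ℚ ℚ.< q × ∃[ s ] (0ℚ ℚ.< s × ¬ Below x s × q ℚ.* s ℚ.< 1ℚ)
  ; positive  = λ (0<q , _) → 0<q
  ; inhabited = let s , 0<s , ¬xs = X.bounded
                    q , 0<q , qs<1 = raise 0<s (subst (ℚ._< 1ℚ) (sym (ℚ.*-zeroˡ s)) 0<1)
                in q , 0<q , s , 0<s , ¬xs , qs<1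
  ; bounded   = let a , xa = X.inhabited
                    i , 0<i , ia≡1 = inverse (X.positive xa)
                in i , 0<i , λ (_ , s , 0<s , ¬xs , is<1) →
                   ℚ.<-irrefl ia≡1 (ℚ.<-trans
                     (ℚ.*-monoʳ-<-pos i {{ℚ.positive 0<i}} (below<above x xa 0<s ¬xs))
                     is<1)
  ; downward  = λ 0<p p<q (_ , s , 0<s , ¬xs , qs<1) →
                  0<p , s , 0<s , ¬xs ,
                  ℚ.<-trans (ℚ.*-monoˡ-<-pos s {{ℚ.positive 0<s}} p<q) qs<1
  ; open-up   = λ (0<p , s , 0<s , ¬xs , ps<1) →
                  let q , p<q , qs<1 = raise 0<s ps<1
                  in q , p<q , ℚ.<-trans 0<p p<q , s , 0<s , ¬xs , qs<1
  }
  where module X = ℝ⁺ x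

infixr 9 _^ᵣ_
_^ᵣ_ : ℝ⁺ → ℕ → ℝ⁺
x ^ᵣ zero  = 1ᵣ
x ^ᵣ suc k = x *ᵣ (x ^ᵣ k)

-- The ceiling is a relation because it is not computable from a cut.
infix 4 ⌈_⌉≡_
⌈_⌉≡_ : ℝ⁺ → ℕ → Set
⌈ x ⌉≡ m = x ≤ℕ m × (∀ k → x ≤ℕ k → m ℕ.≤ k)

record Graph (n : ℕ) : Set₁ where
  field
    Adj    : Rel (Fin n) 0ℓ
    adj?   : Decidable Adj
    symm   : Symmetric Adj
    irrefl : Irreflexive _≡_ Adj

open Graph public using (Adj; adj?)

-- Each edge {u , v} is listed once, as the pair with u < v.
edges : ∀ {n} → Graph n → List (Fin n × Fin n)
edges {n} G =
  filter (λ (u , v) → u <? v ×-dec adj? G u v) (cartesianProduct (allFin n) (allFin n))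

degree : ∀ {n} → Graph n → Fin n → ℕ
degree {n} G u = length (filter (adj? G u) (allFin n))

complete : ∀ n → Graph n
complete n = record
  { Adj    = _≢_
  ; adj?   = λ u v → ¬? (u ≟ v)
  ; symm   = ≢-sym
  ; irrefl = λ u≡v u≢v → u≢v u≡v
  }

infixr 5 _∷_
data Walk {n} (G : Graph n) : ℕ → Fin n → Fin n → Set where
  []  : ∀ {u} → Walk G 0 u u
  _∷_ : ∀ {k u v w} → Adj G u v → Walk G k v w → Walk G (suc k) u w

WithinDistance : ∀ {n} → Graph n → ℕ → Rel (Fin n) 0ℓ
WithinDistance G d u v = ∃[ k ] (k ℕ.≤ d × Walk G k u v)

Connected : ∀ {n} → Graph n → Set
Connected G = ∀ u v → ∃[ k ] Walk G k u v

-- A path with k edges, as the sequence of its k + 1 distinct vertices.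
record IsPath {n} (G : Graph n) {k} (p : Fin (suc k) → Fin n) : Set where
  field
    distinct : Injective _≡_ _≡_ p
    steps    : ∀ i → Adj G (p (inject₁ i)) (p (suc i))

-- A cycle is a path with at least two edges whose ends are adjacent.
Acyclic : ∀ {n} → Graph n → Set
Acyclic {n} G = ∀ k (p : Fin (3 ℕ.+ k) → Fin n) → IsPath G p →
                ¬ Adj G (p (fromℕ (2 ℕ.+ k))) (p zero)

IsTree : ∀ {n} → Graph n → Set
IsTree G = Connected G × Acyclic G

record IsCaterpillar {n} (ℓ : ℕ) (G : Graph n) : Set where
  field
    tree    : IsTree G
    centre  : Fin (suc ℓ) → Fin n
    path    : IsPath G centre
    near    : ∀ v → ∃[ i ] WithinDistance G 1 v (centre i)
    degrees : ∀ i j → degree G (centre i) ℕ.≤ suc (degree G (centre j))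

-- A subgraph has vertex set  vertices  and the edges of  graph , which is kept
-- as a graph on all of Fin n so that edges and degree apply to it.
record Subgraph {n} (G : Graph n) : Set₁ where
  field
    vertices : Subset n
    graph    : Graph n
    inside   : ∀ {u v} → Adj graph u v → u ∈ vertices
    included : ∀ {u v} → Adj graph u v → Adj G u v

-- An isomorphism from H onto the subgraph S.
record IsCopy {m n} (H : Graph m) {G : Graph n} (S : Subgraph G) : Set where
  open Subgraph S
  field
    to        : Fin m → Fin n
    injective : Injective _≡_ _≡_ to
    image     : ∀ v → v ∈ vertices ⇔ (∃[ u ] to u ≡ v)
    adjacency : ∀ u v → Adj H u v ⇔ Adj graph (to u) (to v)

-- Colours are 1, …, r.  Values of colour on pairs that are not edges are junk.
record EdgeColouring (r : ℕ) {n} (G : Graph n) : Set where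
  field
    colour    : Fin n → Fin n → ℕ
    symmetric : ∀ u v → colour u v ≡ colour v u
    range     : ∀ {u v} → Adj G u v → 1 ℕ.≤ colour u v × colour u v ℕ.≤ r

-- Meaningful only when every edge of F is an edge of G.
count : ∀ {r n} {G : Graph n} → EdgeColouring r G → ℕ → Graph n → ℕ
count χ c F = length (filter (λ (u , v) → colour u v ℕ.≟ c) (edges F))
  where open EdgeColouring χ

Balanced : ∀ {r n} {G : Graph n} → EdgeColouring r G → Set
Balanced {r} {G = G} χ = ∀ c d → 1 ℕ.≤ c → c ℕ.≤ r → 1 ℕ.≤ d → d ℕ.≤ r →
                         count χ c G ℕ.≤ suc (count χ d G)

-- Colour 1 is a set of edges inside a small set A of 2h vertices, and the edges
-- leaving A from any one of its vertices receive at most two colours.  Every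
-- edge of a caterpillar has an end on the central path.  So if no central vertex
-- of a copy lies in A, the copy has no edge of colour 1.  Otherwise the edges of
-- colour 1 in the copy number at most |A| times twice the number of central
-- vertices, while a central vertex in A has about n/(ℓ+1) neighbours, nearly all
-- outside A, so one of its two colours wins.  Since colour 1 has about n²/2r
-- edges, h of order n/√r suffices, which is small against n/ℓ² as r ≥ 1/ε⁵.
module Submission where

open import Data.Nat.Base using (ℕ; _≤_; _<_)
open import Data.Product using (Σ-syntax; ∃-syntax; _×_)
open import Defs

open import Algebra.Bundles using (CommutativeRing)
import Algebra.Properties.CommutativeSemiring.Exp as Exp
open import Data.Bool.Base using (if_then_else_; true; false)
open import Data.Fin.Base using (Fin; zero; suc; toℕ; fromℕ; fromℕ<; inject₁)
import Data.Fin.Properties as Fin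
import Data.Integer.Base as ℤ
import Data.Integer.Properties as ℤ
open import Data.List.Base using
  (List; []; _∷_; [_]; _++_; map; length; filter; concatMap; cartesianProduct; upTo; applyUpTo; allFin)
open import Data.List.Membership.Propositional using (_∈_; lose)
open import Data.List.Membership.Propositional.Properties
open import Data.List.Properties hiding (≡-dec)
open import Data.List.Relation.Binary.Permutation.Propositional as ↭ using (_↭_)
import Data.List.Relation.Binary.Permutation.Propositional.Properties as ↭
open import Data.List.Relation.Binary.Subset.Propositional using (_⊆_)
open import Data.List.Relation.Unary.All as All using (All; []; _∷_)
import Data.List.Relation.Unary.All.Properties as All
open import Data.List.Relation.Unary.AllPairs using ([]; _∷_)
open import Data.List.Relation.Unary.Any using (here; there)
open import Data.List.Relation.Unary.Unique.Propositional using (Unique)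
import Data.List.Relation.Unary.Unique.Propositional.Properties as Unique
open import Data.Nat.Base using
  (zero; suc; _+_; _*_; _∸_; _^_; _/_; _%_; NonZero; >-nonZero; >-nonZero⁻¹; z≤n; s≤s; z<s; s<s; s≤s⁻¹; s<s⁻¹)
open import Data.Nat.DivMod
open import Data.Nat.Properties
open import Data.Nat.Solver using (module +-*-Solver)
open import Data.Product using (_,_; proj₁; proj₂; uncurry)
open import Data.Product.Properties using (≡-dec)
open import Data.Rational.Base as ℚ using (ℚ; 0ℚ; 1ℚ; toℚᵘ)
import Data.Rational.Properties as ℚ
open import Data.Rational.Unnormalised.Base as ℚᵘ using (mkℚᵘ)
import Data.Rational.Unnormalised.Properties as ℚᵘ
open import Data.Sum.Base as Sum using (_⊎_; inj₁; inj₂)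
open import Function.Base using (_∘_; id; const)
open import Function.Bundles using (Equivalence)
open import Function.Definitions using (Injective)
open import Level using (Level)
open import Relation.Binary.Definitions using (DecidableEquality; tri<; tri≈; tri>)
open import Relation.Binary.PropositionalEquality hiding ([_])
open import Relation.Nullary using (¬_; yes; no; does; contradiction)
open import Relation.Nullary.Decidable using (_×-dec_)
open import Relation.Unary using (Pred) renaming (Decidable to Decidable₁)

open Exp (CommutativeRing.commutativeSemiring ℚ.+-*-commutativeRing) using (^-distrib-*) renaming (_^_ to _^ℚ_)
open +-*-Solver using (solve; _:+_; _:*_; _:=_; con)

-- Lists

-- The obstacle is to have exact balance and local structure at once. Cutting one linear order of
-- all edges into equal consecutive blocks gives balance whatever the order is, so the structure is
-- put into the order alone: edges within A come first, then the edges at each vertex stay together.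
-- The size of A is squeezed from both sides. With `t` = 4(ℓ+2)² and `h` about n/2t, A must be small
-- enough that a central degree, at least n/(ℓ+1) - 2, exceeds |A| = 2h plus twice the bound 4(ℓ+1)h
-- on the edges of colour 1; the coefficient 2t = 8(ℓ+2)² of h in n achieves this. A must also be
-- large enough that h² edges hold the whole of colour 1; as n is at most 4th, this asks for r ≥
-- 16t² = 256(ℓ+2)⁴. Since ℓ is 1/ε rounded up, r is only known to be at least (ℓ-1)⁵; for ε <
-- 1/4096 four of these factors replace (ℓ+2)⁴ and the fifth absorbs the constants.

private variable
  ℓ₁ ℓ₂ ℓ₃ : Level
  A : Set ℓ₁
  B : Set ℓ₂

-- Each head is deleted from `ys`, and uniqueness keeps the tail inside what remains. Most
-- cardinality bounds below are such inclusions, usually after mapping along an injection.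
length-⊆ : {xs ys : List A} → Unique xs → xs ⊆ ys → length xs ≤ length ys
length-⊆ [] _ = z≤n
length-⊆ {xs = x ∷ xs} (x∉ ∷ xs!) xs⊆ with ∈-∃++ (xs⊆ (here refl))
... | as , bs , refl = begin
  suc (length xs)              ≤⟨ s≤s (length-⊆ xs! without-x) ⟩
  suc (length (as ++ bs))      ≡⟨ ↭.↭-length (↭.shift x as bs) ⟨
  length (as ++ [ x ] ++ bs)   ∎
  where
  open ≤-Reasoning
  without-x : xs ⊆ as ++ bs
  without-x y∈ with ↭.∈-resp-↭ (↭.shift x as bs) (xs⊆ (there y∈))
  ... | here refl = contradiction refl (All.lookup x∉ y∈)
  ... | there y∈′ = y∈′

length-cartesianProduct : (xs : List A) (ys : List B) →
                          length (cartesianProduct xs ys) ≡ length xs * length ys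
length-cartesianProduct []       ys = refl
length-cartesianProduct (x ∷ xs) ys = trans (length-++ (map (x ,_) ys))
  (cong₂ _+_ (length-map (x ,_) ys) (length-cartesianProduct xs ys))

length-concatMap-≤ : {f : A → List B} {m : ℕ} (xs : List A) →
                     (∀ x → length (f x) ≤ m) → length (concatMap f xs) ≤ length xs * m
length-concatMap-≤ []       f≤ = z≤n
length-concatMap-≤ {f = f} (x ∷ xs) f≤ = begin
  length (f x ++ concatMap f xs)          ≡⟨ length-++ (f x) ⟩
  length (f x) + length (concatMap f xs)  ≤⟨ +-mono-≤ (f≤ x) (length-concatMap-≤ xs f≤) ⟩
  _                                       ∎
  where open ≤-Reasoning

length-filter-map : {P : Pred B ℓ₃} (P? : Decidable₁ P) (f : A → B) (xs : List A) →
                    length (filter (P? ∘ f) xs) ≡ length (filter P? (map f xs))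
length-filter-map P? f [] = refl
length-filter-map P? f (x ∷ xs) with does (P? (f x))
... | true  = cong suc (length-filter-map P? f xs)
... | false = length-filter-map P? f xs

applyUpTo-+ : (f : ℕ → A) (m n : ℕ) →
              applyUpTo f (m + n) ≡ applyUpTo f m ++ applyUpTo (f ∘ (m +_)) n
applyUpTo-+ f zero    n = refl
applyUpTo-+ f (suc m) n = cong (f 0 ∷_) (applyUpTo-+ (f ∘ suc) m n)

applyUpTo-cong : {f g : ℕ → A} (n : ℕ) → (∀ i → i < n → f i ≡ g i) →
                 applyUpTo f n ≡ applyUpTo g n
applyUpTo-cong zero    f≗g = refl
applyUpTo-cong (suc n) f≗g =
  cong₂ _∷_ (f≗g 0 z<s) (applyUpTo-cong n (λ i i<n → f≗g (suc i) (s<s i<n)))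

-- Only a permutation, since the elements of the two kinds may interleave in `xs`.
filter-⊎ : ∀ {P Q R : Pred A ℓ₃} (P? : Decidable₁ P) (Q? : Decidable₁ Q) (R? : Decidable₁ R) →
           (∀ {x} → P x → ¬ Q x) → (∀ {x} → P x → R x) → (∀ {x} → Q x → R x) →
           (∀ {x} → R x → P x ⊎ Q x) →
           ∀ xs → filter R? xs ↭ filter P? xs ++ filter Q? xs
filter-⊎ P? Q? R? disj P⇒R Q⇒R R⇒P⊎Q = go
  where
  go : ∀ xs → filter R? xs ↭ filter P? xs ++ filter Q? xs
  go [] = ↭.↭-refl
  go (x ∷ xs) with P? x | Q? x | R? x
  ... | yes px | yes qx | _      = contradiction qx (disj px)
  ... | yes px | no  _  | no ¬rx = contradiction (P⇒R px) ¬rx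
  ... | no  _  | yes qx | no ¬rx = contradiction (Q⇒R qx) ¬rx
  ... | no ¬px | no ¬qx | yes rx = contradiction (R⇒P⊎Q rx) Sum.[ ¬px , ¬qx ]
  ... | no  _  | no  _  | no  _  = go xs
  ... | yes _  | no  _  | yes _  = ↭.prep x (go xs)
  ... | no  _  | yes _  | yes _  =
    ↭.↭-trans (↭.prep x (go xs)) (↭.↭-sym (↭.shift x (filter P? xs) (filter Q? xs)))

module Position {A : Set ℓ₁} (_≟ₐ_ : DecidableEquality A) where

  -- An absent element gets the length of the list, one past the last position.
  position : List A → A → ℕ
  position []       e = 0
  position (x ∷ xs) e = if does (e ≟ₐ x) then 0 else suc (position xs e)

  position-< : ∀ {xs e} → e ∈ xs → position xs e < length xs
  position-< {x ∷ xs} {e} e∈ with e ≟ₐ x | e∈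
  ... | yes _   | _         = z<s
  ... | no e≢x  | here e≡x  = contradiction e≡x e≢x
  ... | no _    | there e∈′ = s<s (position-< e∈′)

  map-position : ∀ {xs} → Unique xs → map (position xs) xs ≡ upTo (length xs)
  map-position [] = refl
  map-position {x ∷ xs} (x∉ ∷ xs!) = cong₂ _∷_ head tail
    where
    head : position (x ∷ xs) x ≡ 0
    head with x ≟ₐ x
    ... | yes _  = refl
    ... | no x≢x = contradiction refl x≢x

    later : ∀ {y} → x ≢ y → position (x ∷ xs) y ≡ suc (position xs y)
    later {y} x≢y with y ≟ₐ x
    ... | yes y≡x = contradiction (sym y≡x) x≢y
    ... | no _    = refl

    tail : map (position (x ∷ xs)) xs ≡ applyUpTo suc (length xs)
    tail = begin
      map (position (x ∷ xs)) xs      ≡⟨ map-cong-local (All.map later x∉) ⟩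
      map (suc ∘ position xs) xs      ≡⟨ map-∘ xs ⟩
      map suc (map (position xs) xs)  ≡⟨ cong (map suc) (map-position xs!) ⟩
      map suc (upTo (length xs))      ≡⟨ map-upTo suc (length xs) ⟩
      applyUpTo suc (length xs)       ∎
      where open ≡-Reasoning

  -- The position of an element in the list sorted stably by key.
  module Rank (xs : List A) (key : A → ℕ) where

    below at : ℕ → List A
    below k = filter (λ e → key e <? k) xs
    at    k = filter (λ e → key e ≟ k) xs

    below-suc : ∀ k → below (suc k) ↭ below k ++ at k
    below-suc k = filter-⊎ (λ e → key e <? k) (λ e → key e ≟ k) (λ e → key e <? suc k)
      (λ x<k x≡k → <⇒≢ x<k x≡k) m<n⇒m<1+n (λ x≡k → s≤s (≤-reflexive x≡k))
      (λ x<1+k → m≤n⇒m<n∨m≡n (s≤s⁻¹ x<1+k)) xs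

    length-below-suc : ∀ k → length (below (suc k)) ≡ length (below k) + length (at k)
    length-below-suc k = trans (↭.↭-length (below-suc k)) (length-++ (below k))

    rank : A → ℕ
    rank e = length (below (key e)) + position (at (key e)) e

    -- Together with `rank-<`, this confines the ranks of one key to an interval with ends given by
    -- `below`. The colour estimates use nothing else about ranks.
    rank-≥ : ∀ e → length (below (key e)) ≤ rank e
    rank-≥ e = m≤m+n _ _

    rank-< : ∀ {e} → e ∈ xs → rank e < length (below (suc (key e)))
    rank-< {e} e∈ rewrite length-below-suc (key e) =
      +-monoʳ-< (length (below (key e)))
        (position-< (∈-filter⁺ (λ x → key x ≟ key e) e∈ refl))

    -- By induction on `k`: the elements of key `k` occupy exactly the interval of ranks that
    -- follows those of `below k`.
    map-rank-below : Unique xs → ∀ k → map rank (below k) ↭ upTo (length (below k))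
    map-rank-below xs! zero rewrite filter-none (λ e → key e <? 0) {xs} (All.tabulate (λ _ → n≮0)) =
      ↭.↭-refl
    map-rank-below xs! (suc k) = begin
      map rank (below (suc k))                ↭⟨ ↭.map⁺ rank (below-suc k) ⟩
      map rank (below k ++ at k)              ≡⟨ map-++ rank (below k) (at k) ⟩
      map rank (below k) ++ map rank (at k)   ≡⟨ cong (map rank (below k) ++_) on-bucket ⟩
      map rank (below k) ++ applyUpTo (b +_) (length (at k))
                                              ↭⟨ ↭.++⁺ʳ _ (map-rank-below xs! k) ⟩
      upTo b ++ applyUpTo (b +_) (length (at k))
                                              ≡⟨ applyUpTo-+ id b (length (at k)) ⟨
      upTo (b + length (at k))                ≡⟨ cong upTo (length-below-suc k) ⟨
      upTo (length (below (suc k)))           ∎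
      where
      open ↭.PermutationReasoning
      b = length (below k)
      key≡k : ∀ {e} → e ∈ at k → rank e ≡ b + position (at k) e
      key≡k e∈ with ∈-filter⁻ (λ e → key e ≟ k) {xs = xs} e∈
      ... | _ , refl = refl
      on-bucket : map rank (at k) ≡ applyUpTo (b +_) (length (at k))
      on-bucket = E.begin
        map rank (at k)                            E.≡⟨ map-cong-local (All.tabulate key≡k) ⟩
        map ((b +_) ∘ position (at k)) (at k)      E.≡⟨ map-∘ (at k) ⟩
        map (b +_) (map (position (at k)) (at k))  E.≡⟨ cong (map (b +_)) (map-position (Unique.filter⁺ _ xs!)) ⟩
        map (b +_) (upTo (length (at k)))          E.≡⟨ map-upTo (b +_) _ ⟩
        applyUpTo (b +_) (length (at k))           E.∎
        where module E = ≡-Reasoning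

    map-rank : Unique xs → ∀ K → (∀ e → key e < K) → map rank xs ↭ upTo (length xs)
    map-rank xs! K key<K =
      subst (λ ys → map rank ys ↭ upTo (length ys))
        (filter-all (λ e → key e <? K) (All.tabulate λ {e} _ → key<K e)) (map-rank-below xs! K)

-- Colouring an interval in blocks

occurrences : ℕ → List ℕ → ℕ
occurrences c xs = length (filter (_≟ c) xs)

occurrences-++ : ∀ c xs ys → occurrences c (xs ++ ys) ≡ occurrences c xs + occurrences c ys
occurrences-++ c xs ys = trans (cong length (filter-++ (_≟ c) xs ys)) (length-++ (filter (_≟ c) xs))

occurrences-map-suc : ∀ c xs → occurrences (suc c) (map suc xs) ≡ occurrences c xs
occurrences-map-suc c xs = trans (sym (length-filter-map (_≟ suc c) suc xs))
  (cong length (filter-≐ (λ x → suc x ≟ suc c) (_≟ c) (suc-injective , cong suc) xs))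

occurrences-absent : ∀ {c xs} → All (_≢ c) xs → occurrences c xs ≡ 0
occurrences-absent {c} absent = cong length (filter-none (_≟ c) absent)

occurrences-unique : ∀ c {xs} → Unique xs → occurrences c xs ≤ 1
occurrences-unique c {xs} xs! = length-⊆ {ys = [ c ]} (Unique.filter⁺ (_≟ c) xs!)
  λ x∈ → here (proj₂ (∈-filter⁻ (_≟ c) {xs = xs} x∈))

module _ (q : ℕ) .{{_ : NonZero q}} where

  [m+n]/m≡1+n/m : ∀ n → (q + n) / q ≡ suc (n / q)
  [m+n]/m≡1+n/m n = trans (m/n≡1+[m∸n]/n (m≤m+n q n)) (cong (λ x → suc (x / q)) (m+n∸m≡n q n))

  -- By induction on `m`: the first `q` quotients are 0, and the others are the list for the smaller
  -- `m` with every entry raised by 1.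
  occurrences-quotient : ∀ m c → c < m → occurrences c (applyUpTo (_/ q) (m * q)) ≡ q
  occurrences-quotient (suc m) c c<1+m = begin
    occurrences c (applyUpTo (_/ q) (q + m * q))
      ≡⟨ cong (occurrences c) (applyUpTo-+ (_/ q) q (m * q)) ⟩
    occurrences c (applyUpTo (_/ q) q ++ applyUpTo (λ i → (q + i) / q) (m * q))
      ≡⟨ cong₂ (λ xs ys → occurrences c (xs ++ ys))
           (applyUpTo-cong q (λ i → m<n⇒m/n≡0))
           (applyUpTo-cong (m * q) (λ i _ → [m+n]/m≡1+n/m i)) ⟩
    occurrences c (zeros ++ applyUpTo (suc ∘ (_/ q)) (m * q))
      ≡⟨ occurrences-++ c zeros _ ⟩
    occurrences c zeros + occurrences c (applyUpTo (suc ∘ (_/ q)) (m * q))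
      ≡⟨ cong (occurrences c zeros +_) (cong (occurrences c) (map-applyUpTo (_/ q) suc (m * q))) ⟨
    occurrences c zeros + occurrences c (map suc (applyUpTo (_/ q) (m * q)))
      ≡⟨ split c c<1+m ⟩
    q ∎
    where
    open ≡-Reasoning
    zeros = applyUpTo (const 0) q
    split : ∀ c → c < suc m →
            occurrences c zeros + occurrences c (map suc (applyUpTo (_/ q) (m * q))) ≡ q
    split zero _ = begin
      occurrences 0 zeros + occurrences 0 (map suc (applyUpTo (_/ q) (m * q)))
        ≡⟨ cong₂ _+_ (trans (cong length (filter-all (_≟ 0) (All.applyUpTo⁺₂ (const 0) q (λ _ → refl))))
                            (length-applyUpTo (const 0) q))
                     (trans (cong (occurrences 0) (map-applyUpTo (_/ q) suc (m * q)))
                            (occurrences-absent (All.applyUpTo⁺₂ (suc ∘ (_/ q)) (m * q) (λ _ ())))) ⟩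
      q + 0  ≡⟨ +-identityʳ q ⟩
      q      ∎
    split (suc c) (s≤s c<m) = begin
      occurrences (suc c) zeros + occurrences (suc c) (map suc (applyUpTo (_/ q) (m * q)))
        ≡⟨ cong₂ _+_ (occurrences-absent (All.applyUpTo⁺₂ (const 0) q (λ _ ())))
                     (occurrences-map-suc c (applyUpTo (_/ q) (m * q))) ⟩
      occurrences c (applyUpTo (_/ q) (m * q))  ≡⟨ occurrences-quotient m c c<m ⟩
      q                                         ∎

module BlockColour (r q : ℕ) .{{_ : NonZero q}} where

  -- The numbers left over after r blocks avoid colour 1, so that colour 1 is
  -- exactly the first block; they stay within the r colours if fewer than r.
  blockColour : ℕ → ℕ
  blockColour i with i <? r * q
  ... | yes _ = suc (i / q)
  ... | no  _ = 2 + (i ∸ r * q)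

  blockColour-< : ∀ {i} → i < r * q → blockColour i ≡ suc (i / q)
  blockColour-< {i} i< with i <? r * q
  ... | yes _ = refl
  ... | no i≮ = contradiction i< i≮

  blockColour-≥ : ∀ j → blockColour (r * q + j) ≡ 2 + j
  blockColour-≥ j with r * q + j <? r * q
  ... | yes i< = contradiction i< (m+n≮m (r * q) j)
  ... | no _   = cong (2 +_) (m+n∸m≡n (r * q) j)

  blockColour-1 : ∀ {i} → blockColour i ≡ 1 → i < q
  blockColour-1 {i} eq with i <? r * q
  ... | yes _ = m/n≡0⇒m<n (suc-injective eq)
  blockColour-1 {i} () | no _

  blockColour-range : ∀ {s i} → s < r → i < r * q + s → 1 ≤ blockColour i × blockColour i ≤ r
  blockColour-range {s} {i} s<r i<E with i <? r * q
  ... | yes i< = s≤s z≤n , m<n*o⇒m/o<n i<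
  -- A leftover index is below `s`, so its colour is at most `1 + s`, hence at most `r`.
  ... | no i≮  = s≤s z≤n , ≤-trans (s≤s i-rq<s) s<r
    where
    i-rq<s : i ∸ r * q < s
    i-rq<s = subst (i ∸ r * q <_) (m+n∸m≡n (r * q) s) (∸-monoˡ-< i<E (≮⇒≥ i≮))

  -- Every colour owns one full block, and the leftover numbers have pairwise distinct colours, so
  -- each colour gains at most one more.
  occurrences-blockColour : ∀ s c → 1 ≤ c → c ≤ r →
                            let k = occurrences c (map blockColour (upTo (r * q + s))) in
                            q ≤ k × k ≤ suc q
  occurrences-blockColour s (suc c) _ c<r = subst (λ k → q ≤ k × k ≤ suc q) (sym eq)
    (m≤m+n q _ , ≤-trans (+-monoʳ-≤ q at-most-one) (≤-reflexive (+-comm q 1)))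
    where
    extra = applyUpTo (2 +_) s
    at-most-one : occurrences (suc c) extra ≤ 1
    at-most-one = occurrences-unique (suc c)
      (Unique.applyUpTo⁺₁ _ s λ i<j _ → <⇒≢ i<j ∘ suc-injective ∘ suc-injective)
    open ≡-Reasoning
    eq : occurrences (suc c) (map blockColour (upTo (r * q + s))) ≡ q + occurrences (suc c) extra
    eq = begin
      occurrences (suc c) (map blockColour (upTo (r * q + s)))
        ≡⟨ cong (occurrences (suc c)) (map-upTo blockColour (r * q + s)) ⟩
      occurrences (suc c) (applyUpTo blockColour (r * q + s))
        ≡⟨ cong (occurrences (suc c)) (applyUpTo-+ blockColour (r * q) s) ⟩
      occurrences (suc c) (applyUpTo blockColour (r * q) ++ applyUpTo (blockColour ∘ (r * q +_)) s)
        ≡⟨ cong₂ (λ xs ys → occurrences (suc c) (xs ++ ys))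
             (trans (applyUpTo-cong (r * q) (λ i → blockColour-<))
                    (sym (map-applyUpTo (_/ q) suc (r * q))))
             (applyUpTo-cong s (λ j _ → blockColour-≥ j)) ⟩
      occurrences (suc c) (map suc (applyUpTo (_/ q) (r * q)) ++ extra)
        ≡⟨ occurrences-++ (suc c) (map suc (applyUpTo (_/ q) (r * q))) extra ⟩
      occurrences (suc c) (map suc (applyUpTo (_/ q) (r * q))) + occurrences (suc c) extra
        ≡⟨ cong (_+ _) (trans (occurrences-map-suc c (applyUpTo (_/ q) (r * q))) (occurrences-quotient q r c c<r)) ⟩
      q + occurrences (suc c) extra ∎

-- Caterpillars

within-1 : ∀ {n} {G : Graph n} {u v} → WithinDistance G 1 u v → u ≡ v ⊎ Adj G u v
within-1 (_ , _ , [])             = inj₁ refl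
within-1 (_ , _ , (uv ∷ []))      = inj₂ uv
within-1 (_ , s≤s () , (_ ∷ _ ∷ _))

-- Frees `steps` from `inject₁`: the vertices of a stretch of the path are known only through their
-- `toℕ`.
path-edge : ∀ {n} {G : Graph n} {k} {p : Fin (suc k) → Fin n} → IsPath G p →
            ∀ x y → toℕ y ≡ suc (toℕ x) → Adj G (p x) (p y)
path-edge {G = G} {p = p} P x (suc y) eq =
  subst (λ z → Adj G (p z) (p (suc y)))
    (Fin.toℕ-injective (trans (Fin.toℕ-inject₁ y) (suc-injective eq))) (IsPath.steps P y)

module Caterpillar {n ℓ} {H : Graph n} (H-cat : IsCaterpillar ℓ H) where
  open IsCaterpillar H-cat
  open Graph H using (symm; irrefl)

  -- The closed neighbourhoods of the central vertices cover the tree, and each has at most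
  -- `2 + degree H (centre j)` elements because central degrees differ by at most 1. This is the
  -- lower bound on central degrees.
  order-≤ : ∀ j → n ≤ suc ℓ * (2 + degree H (centre j))
  order-≤ j = begin
    n                                          ≡⟨ length-tabulate id ⟨
    length (allFin n)                          ≤⟨ length-⊆ (Unique.allFin⁺ n) cover ⟩
    length (concatMap star (allFin (suc ℓ)))   ≤⟨ length-concatMap-≤ {f = star} (allFin (suc ℓ)) (λ i → s≤s (degrees i j)) ⟩
    length (allFin (suc ℓ)) * (2 + degree H (centre j))
                                               ≡⟨ cong (_* (2 + degree H (centre j))) (length-tabulate {n = suc ℓ} id) ⟩
    suc ℓ * (2 + degree H (centre j))          ∎
    where
    open ≤-Reasoning
    star : Fin (suc ℓ) → List (Fin n)
    star i = centre i ∷ filter (adj? H (centre i)) (allFin n)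
    cover : ∀ {v} → v ∈ allFin n → v ∈ concatMap star (allFin (suc ℓ))
    cover {v} _ with near v
    ... | i , d≤1 = ∈-concatMap⁺ star {xs = allFin (suc ℓ)} (lose (∈-allFin i) (in-star (within-1 d≤1)))
      where
      in-star : v ≡ centre i ⊎ Adj H v (centre i) → v ∈ star i
      in-star (inj₁ v≡c) = here v≡c
      in-star (inj₂ vc)  = there (∈-filter⁺ (adj? H (centre i)) (∈-allFin v) (symm vc))

  module _ {u v} (u≢ : ∀ i → u ≢ centre i) (v≢ : ∀ i → v ≢ centre i) where

    -- The cycle  v, u, centre i, …, centre j.
    no-leaf-cycle : ∀ {i j} d → toℕ i + d ≡ toℕ j →
                    Adj H v u → Adj H u (centre i) → ¬ Adj H (centre j) v
    no-leaf-cycle {i} {j} d i+d≡j vu ui jv =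
      -- For `d` = 0 both vertices are attached to the same central vertex and the cycle is a
      -- triangle.
      proj₂ tree d p (record { distinct = p-injective ; steps = p-steps })
        (subst (λ x → Adj H (centre x) v) (sym last) jv)
      where
      bound : ∀ (t : Fin (suc d)) → toℕ i + toℕ t < suc ℓ
      bound t = ≤-<-trans (+-monoʳ-≤ (toℕ i) (Fin.toℕ≤pred[n] t))
                          (subst (_< suc ℓ) (sym i+d≡j) (Fin.toℕ<n j))

      shifted : Fin (suc d) → Fin (suc ℓ)
      shifted t = fromℕ< (bound t)

      toℕ-shifted : ∀ t → toℕ (shifted t) ≡ toℕ i + toℕ t
      toℕ-shifted t = Fin.toℕ-fromℕ< (bound t)

      last : shifted (fromℕ d) ≡ j
      last = Fin.toℕ-injective (trans (toℕ-shifted (fromℕ d))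
               (trans (cong (toℕ i +_) (Fin.toℕ-fromℕ d)) i+d≡j))

      first : shifted zero ≡ i
      first = Fin.toℕ-injective (trans (toℕ-shifted zero) (+-identityʳ (toℕ i)))

      p : Fin (3 + d) → Fin n
      p zero          = v
      p (suc zero)    = u
      p (suc (suc t)) = centre (shifted t)

      p-injective : Injective _≡_ _≡_ p
      p-injective {zero}        {zero}        _  = refl
      p-injective {zero}        {suc zero}    eq = contradiction vu (irrefl eq)
      p-injective {zero}        {suc (suc t)} eq = contradiction eq (v≢ _)
      p-injective {suc zero}    {zero}        eq = contradiction vu (irrefl (sym eq))
      p-injective {suc zero}    {suc zero}    _  = refl
      p-injective {suc zero}    {suc (suc t)} eq = contradiction eq (u≢ _)
      p-injective {suc (suc s)} {zero}        eq = contradiction (sym eq) (v≢ _)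
      p-injective {suc (suc s)} {suc zero}    eq = contradiction (sym eq) (u≢ _)
      p-injective {suc (suc s)} {suc (suc t)} eq = cong (λ t → suc (suc t)) (Fin.toℕ-injective
        (+-cancelˡ-≡ (toℕ i) (toℕ s) (toℕ t) (begin
          toℕ i + toℕ s    ≡⟨ toℕ-shifted s ⟨
          toℕ (shifted s)  ≡⟨ cong toℕ (IsPath.distinct path eq) ⟩
          toℕ (shifted t)  ≡⟨ toℕ-shifted t ⟩
          toℕ i + toℕ t    ∎)))
        where open ≡-Reasoning

      p-steps : ∀ t → Adj H (p (inject₁ t)) (p (suc t))
      p-steps zero          = vu
      p-steps (suc zero)    = subst (λ x → Adj H u (centre x)) (sym first) ui
      p-steps (suc (suc t)) = path-edge path (shifted (inject₁ t)) (shifted (suc t)) (begin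
        toℕ (shifted (suc t))              ≡⟨ toℕ-shifted (suc t) ⟩
        toℕ i + suc (toℕ t)                ≡⟨ +-suc (toℕ i) (toℕ t) ⟩
        suc (toℕ i + toℕ t)                ≡⟨ cong (λ x → suc (toℕ i + x)) (Fin.toℕ-inject₁ t) ⟨
        suc (toℕ i + toℕ (inject₁ t))      ≡⟨ cong suc (toℕ-shifted (inject₁ t)) ⟨
        suc (toℕ (shifted (inject₁ t)))    ∎)
        where open ≡-Reasoning

  Central : Fin n → Set
  Central u = ∃[ i ] u ≡ centre i

  attached : ∀ {u} → (∀ i → u ≢ centre i) → ∃[ i ] Adj H u (centre i)
  attached {u} u≢ with near u
  ... | i , d≤1 with within-1 d≤1
  ...   | inj₁ u≡c = contradiction u≡c (u≢ i)
  ...   | inj₂ uc  = i , uc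

  -- Two adjacent vertices off the path would each be attached to it, and the stretch of the path
  -- between the two attachments would close a cycle. The order of the attachments decides which of
  -- the two vertices comes first in it.
  edge-central : ∀ {u v} → Adj H u v → Central u ⊎ Central v
  edge-central {u} {v} uv with Fin.any? (λ i → u Fin.≟ centre i) | Fin.any? (λ i → v Fin.≟ centre i)
  ... | yes cu | _      = inj₁ cu
  ... | no _   | yes cv = inj₂ cv
  ... | no ¬cu | no ¬cv with attached (λ i eq → ¬cu (i , eq)) | attached (λ i eq → ¬cv (i , eq))
  ...   | i , ui | j , vj with ≤-total (toℕ i) (toℕ j)
  ...     | inj₁ i≤j = contradiction (symm vj)
    (no-leaf-cycle (λ i eq → ¬cu (i , eq)) (λ i eq → ¬cv (i , eq)) _ (m+[n∸m]≡n i≤j) (symm uv) ui)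
  ...     | inj₂ j≤i = contradiction (symm ui)
    (no-leaf-cycle (λ i eq → ¬cv (i , eq)) (λ i eq → ¬cu (i , eq)) _ (m+[n∸m]≡n j≤i) uv vj)

module Copy {n ℓ} {H G : Graph n} (H-cat : IsCaterpillar ℓ H)
            {S : Subgraph G} (copy : IsCopy H S) where
  open IsCaterpillar H-cat using (centre)
  open IsCopy copy
  open Subgraph S

  copied-centre : Fin (suc ℓ) → Fin n
  copied-centre i = to (centre i)

  -- By `inside`, both ends of an edge of the copy are images under `to`, so the edge pulls back to
  -- `H`.
  copied-edge-central : ∀ {x y} → Adj graph x y → (∃[ i ] x ≡ copied-centre i) ⊎ (∃[ i ] y ≡ copied-centre i)
  copied-edge-central {x} {y} xy
    with Equivalence.to (image x) (inside xy) | Equivalence.to (image y) (inside (Graph.symm graph xy))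
  ... | u , refl | v , refl =
    Sum.map lift lift (Caterpillar.edge-central H-cat (Equivalence.from (adjacency u v) xy))
    where
    lift : ∀ {w} → ∃[ i ] w ≡ centre i → ∃[ i ] to w ≡ copied-centre i
    lift (i , refl) = i , refl

  degree-≤ : ∀ u → degree H u ≤ degree graph (to u)
  degree-≤ u = begin
    length (filter (adj? H u) (allFin n))           ≡⟨ length-map to (filter (adj? H u) (allFin n)) ⟨
    length (map to (filter (adj? H u) (allFin n)))  ≤⟨ length-⊆ (Unique.map⁺ injective
                                                         (Unique.filter⁺ (adj? H u) (Unique.allFin⁺ n))) neighbours-⊆ ⟩
    length (filter (adj? graph (to u)) (allFin n))  ∎
    where
    open ≤-Reasoning
    neighbours-⊆ : map to (filter (adj? H u) (allFin n)) ⊆ filter (adj? graph (to u)) (allFin n)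
    neighbours-⊆ y∈ with ∈-map⁻ to y∈
    ... | v , v∈ , refl = ∈-filter⁺ (adj? graph (to u)) (∈-allFin (to v))
      (Equivalence.to (adjacency u v) (proj₂ (∈-filter⁻ (adj? H u) {xs = allFin n} v∈)))

-- The colouring

module _ {n} (G : Graph n) where

  private
    edge? : Decidable₁ {A = Fin n × Fin n} (λ (u , v) → toℕ u < toℕ v × Adj G u v)
    edge? (u , v) = u Fin.<? v ×-dec adj? G u v

  ∈-edges⁺ : ∀ {u v} → toℕ u < toℕ v → Adj G u v → (u , v) ∈ edges G
  ∈-edges⁺ {u} {v} u<v uv =
    ∈-filter⁺ edge? (∈-cartesianProduct⁺ (∈-allFin u) (∈-allFin v)) (u<v , uv)

  ∈-edges⁻ : ∀ {u v} → (u , v) ∈ edges G → toℕ u < toℕ v × Adj G u v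
  ∈-edges⁻ uv∈ = proj₂ (∈-filter⁻ edge? {xs = cartesianProduct (allFin n) (allFin n)} uv∈)

  edges-unique : Unique (edges G)
  edges-unique = Unique.filter⁺ edge? (Unique.cartesianProduct⁺ (Unique.allFin⁺ n) (Unique.allFin⁺ n))

initial : ∀ n → ℕ → List (Fin n)
initial n m = filter (λ x → toℕ x <? m) (allFin n)

∈-initial : ∀ {n m} {x : Fin n} → toℕ x < m → x ∈ initial n m
∈-initial {m = m} {x} = ∈-filter⁺ (λ x → toℕ x <? m) (∈-allFin x)

length-initial : ∀ n m → length (initial n m) ≤ m
length-initial n m = begin
  length (initial n m)            ≡⟨ length-map toℕ (initial n m) ⟨
  length (map toℕ (initial n m))  ≤⟨ length-⊆ (Unique.map⁺ Fin.toℕ-injective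
                                       (Unique.filter⁺ (λ x → toℕ x <? m) (Unique.allFin⁺ n))) below-m ⟩
  length (upTo m)                 ≡⟨ length-upTo m ⟩
  m                               ∎
  where
  open ≤-Reasoning
  below-m : map toℕ (initial n m) ⊆ upTo m
  below-m y∈ with ∈-map⁻ toℕ y∈
  ... | x , x∈ , refl = ∈-upTo⁺ (proj₂ (∈-filter⁻ (λ x → toℕ x <? m) {xs = allFin n} x∈))

-- The complete bipartite graph between the two halves of A, where A consists of the vertices below
-- `h + h`. Colour 1 is taken from its edges.
Crossing : ∀ {n} → ℕ → Fin n × Fin n → Set
Crossing h (u , v) = toℕ u < h × h ≤ toℕ v × toℕ v < h + h

crossing? : ∀ {n} h → Decidable₁ (Crossing {n} h)
crossing? h (u , v) = toℕ u <? h ×-dec h ≤? toℕ v ×-dec toℕ v <? h + h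

-- Applied twice: with `h`, to make room for colour 1 inside A, and with `t * h`, as a lower bound
-- on the number of all edges.
length-crossing : ∀ {n} h → h + h ≤ n → h * h ≤ length (filter (crossing? h) (edges (complete n)))
length-crossing {n} h 2h≤n = begin
  h * h                                   ≡⟨ cong₂ _*_ (length-tabulate {n = h} id) (length-tabulate {n = h} id) ⟨
  length (allFin h) * length (allFin h)   ≡⟨ length-cartesianProduct (allFin h) (allFin h) ⟨
  length square                           ≡⟨ length-map embed square ⟨
  length (map embed square)               ≤⟨ length-⊆ (Unique.map⁺ embed-injective
                                               (Unique.cartesianProduct⁺ (Unique.allFin⁺ h) (Unique.allFin⁺ h))) embed-∈ ⟩
  length (filter (crossing? h) (edges (complete n)))  ∎
  where
  open ≤-Reasoning
  square = cartesianProduct (allFin h) (allFin h)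
  left< : ∀ (i : Fin h) → toℕ i < n
  left< i = <-≤-trans (Fin.toℕ<n i) (≤-trans (m≤m+n h h) 2h≤n)
  right< : ∀ (j : Fin h) → h + toℕ j < n
  right< j = <-≤-trans (+-monoʳ-< h (Fin.toℕ<n j)) 2h≤n
  embed : Fin h × Fin h → Fin n × Fin n
  embed (i , j) = fromℕ< (left< i) , fromℕ< (right< j)
  toℕ-left : ∀ i → toℕ (fromℕ< (left< i)) ≡ toℕ i
  toℕ-left i = Fin.toℕ-fromℕ< (left< i)
  toℕ-right : ∀ j → toℕ (fromℕ< (right< j)) ≡ h + toℕ j
  toℕ-right j = Fin.toℕ-fromℕ< (right< j)
  embed-injective : ∀ {x y} → embed x ≡ embed y → x ≡ y
  embed-injective {i , j} {i′ , j′} eq = cong₂ _,_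
    (Fin.toℕ-injective (trans (sym (toℕ-left i)) (trans (cong (toℕ ∘ proj₁) eq) (toℕ-left i′))))
    (Fin.toℕ-injective (+-cancelˡ-≡ h (toℕ j) (toℕ j′)
      (trans (sym (toℕ-right j)) (trans (cong (toℕ ∘ proj₂) eq) (toℕ-right j′)))))
  embed-∈ : map embed square ⊆ filter (crossing? h) (edges (complete n))
  embed-∈ e∈ with ∈-map⁻ embed e∈
  ... | (i , j) , _ , refl = ∈-filter⁺ (crossing? h) (∈-edges⁺ (complete n) u<v (<⇒≢ u<v ∘ cong toℕ))
    ( u<h , h≤v , subst (_< h + h) (sym (toℕ-right j)) (+-monoʳ-< h (Fin.toℕ<n j)))
    where
    u<h : toℕ (fromℕ< (left< i)) < h
    u<h = subst (_< h) (sym (toℕ-left i)) (Fin.toℕ<n i)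
    h≤v : h ≤ toℕ (fromℕ< (right< j))
    h≤v = subst (h ≤_) (sym (toℕ-right j)) (m≤m+n h (toℕ j))
    u<v : toℕ (fromℕ< (left< i)) < toℕ (fromℕ< (right< j))
    u<v = <-≤-trans u<h h≤v

-- The edges are coloured in blocks of q along the order by key.  At least q edges
-- have key 0, so these contain all of colour 1; the other edges at their smaller
-- end u form the bucket suc u of at most n ≤ q edges, which meets two blocks at most.
module Construction (n r h q s : ℕ) .{{_ : NonZero q}}
                    (size : length (edges (complete n)) ≡ r * q + s) (s<r : s < r) where

  open BlockColour r q

  Pair : Set
  Pair = Fin n × Fin n

  all-edges : List Pair
  all-edges = edges (complete n)

  key : Pair → ℕ
  key e with crossing? h e
  ... | yes _ = 0
  ... | no _  = suc (toℕ (proj₁ e))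

  key-crossing : ∀ {e} → Crossing h e → key e ≡ 0
  key-crossing {e} cr with crossing? h e
  ... | yes _  = refl
  ... | no ¬cr = contradiction cr ¬cr

  key-¬crossing : ∀ {e} → ¬ Crossing h e → key e ≡ suc (toℕ (proj₁ e))
  key-¬crossing {e} ¬cr with crossing? h e
  ... | yes cr = contradiction cr ¬cr
  ... | no _   = refl

  key-0 : ∀ {e} → key e < 1 → Crossing h e
  key-0 {e} k<1 with crossing? h e
  ... | yes cr = cr
  ... | no _   = contradiction k<1 λ { (s≤s ()) }

  key-suc : ∀ {e u} → key e ≡ suc u → toℕ (proj₁ e) ≡ u
  key-suc {e} k≡ with crossing? h e
  key-suc     () | yes _
  ... | no _ = suc-injective k≡

  -- Whatever is ranked before the bucket of a vertex of A starts in A, so at most `(h + h) * n`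
  -- edges precede that bucket.
  key-<-suc : ∀ {e u} → u < h + h → key e < suc u → toℕ (proj₁ e) < h + h
  key-<-suc {e} u<2h k< with crossing? h e
  ... | yes (u<h , _) = <-≤-trans u<h (m≤m+n h h)
  ... | no _          = <-trans (s<s⁻¹ k<) u<2h

  key-< : ∀ e → key e < suc n
  key-< e with crossing? h e
  ... | yes _ = z<s
  ... | no _  = s<s (Fin.toℕ<n (proj₁ e))

  open Position {A = Pair} (≡-dec (Fin._≟_ {n}) (Fin._≟_ {n}))
  open Rank all-edges key

  rank-↭ : map rank all-edges ↭ upTo (length all-edges)
  rank-↭ = map-rank (edges-unique (complete n)) (suc n) key-<

  f : Pair → ℕ
  f = blockColour ∘ rank

  f-range : ∀ {e} → e ∈ all-edges → 1 ≤ f e × f e ≤ r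
  f-range {e} e∈ = blockColour-range s<r
    (subst (rank e <_) size (∈-upTo⁻ (↭.∈-resp-↭ rank-↭ (∈-map⁺ rank e∈))))

  colour : Fin n → Fin n → ℕ
  colour u v with u Fin.<? v
  ... | yes _ = f (u , v)
  ... | no _  = f (v , u)

  colour-< : ∀ {u v} → toℕ u < toℕ v → colour u v ≡ f (u , v)
  colour-< {u} {v} u<v with u Fin.<? v
  ... | yes _  = refl
  ... | no u≮v = contradiction u<v u≮v

  colour-≥ : ∀ {u v} → ¬ toℕ u < toℕ v → colour u v ≡ f (v , u)
  colour-≥ {u} {v} u≮v with u Fin.<? v
  ... | yes u<v = contradiction u<v u≮v
  ... | no _    = refl

  χ : EdgeColouring r (complete n)
  χ = record { colour = colour ; symmetric = symmetric ; range = range }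
    where
    symmetric : ∀ u v → colour u v ≡ colour v u
    symmetric u v with Fin.<-cmp u v
    ... | tri< u<v _ v≮u = trans (colour-< u<v) (sym (colour-≥ v≮u))
    ... | tri≈ _ refl _  = refl
    ... | tri> u≮v _ v<u = trans (colour-≥ u≮v) (sym (colour-< v<u))
    In-range : ℕ → Set
    In-range c = 1 ≤ c × c ≤ r
    range : ∀ {u v} → u ≢ v → 1 ≤ colour u v × colour u v ≤ r
    range {u} {v} u≢v with Fin.<-cmp u v
    ... | tri< u<v _ _   = subst In-range (sym (colour-< u<v)) (f-range (∈-edges⁺ (complete n) u<v u≢v))
    ... | tri≈ _ u≡v _   = contradiction u≡v u≢v
    ... | tri> u≮v _ v<u = subst In-range (sym (colour-≥ u≮v)) (f-range (∈-edges⁺ (complete n) v<u (≢-sym u≢v)))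

  -- The ranks of the edges are a permutation of an initial interval, so the class sizes do not
  -- depend on the key.
  count-all : ∀ c → count χ c (complete n) ≡ occurrences c (map blockColour (upTo (r * q + s)))
  count-all c = begin
    length (filter (λ e → uncurry colour e ≟ c) all-edges)
      ≡⟨ length-filter-map (_≟ c) (uncurry colour) all-edges ⟩
    occurrences c (map (uncurry colour) all-edges)
      ≡⟨ cong (occurrences c) (map-cong-local
           (All.tabulate (λ e∈ → colour-< (proj₁ (∈-edges⁻ (complete n) e∈))))) ⟩
    occurrences c (map f all-edges)
      ≡⟨ cong (occurrences c) (map-∘ all-edges) ⟩
    occurrences c (map blockColour (map rank all-edges))
      ≡⟨ ↭.↭-length (↭.filter-↭ (_≟ c) (↭.map⁺ blockColour rank-↭)) ⟩
    occurrences c (map blockColour (upTo (length all-edges)))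
      ≡⟨ cong (λ m → occurrences c (map blockColour (upTo m))) size ⟩
    occurrences c (map blockColour (upTo (r * q + s))) ∎
    where open ≡-Reasoning

  balanced : Balanced χ
  balanced c d 1≤c c≤r 1≤d d≤r =
    subst₂ (λ x y → x ≤ suc y) (sym (count-all c)) (sym (count-all d))
      (≤-trans (proj₂ (occurrences-blockColour s c 1≤c c≤r))
               (s≤s (proj₁ (occurrences-blockColour s d 1≤d d≤r))))

  module _ (q≤h² : q ≤ h * h) (2h≤n : h + h ≤ n) where

    below-mono : ∀ {k l} → k ≤ l → length (below k) ≤ length (below l)
    below-mono {k} {l} k≤l = length-⊆ (Unique.filter⁺ _ (edges-unique (complete n)))
      λ e∈ → let e∈E , k< = ∈-filter⁻ (λ e → key e <? k) {xs = all-edges} e∈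
             in ∈-filter⁺ (λ e → key e <? l) e∈E (<-≤-trans k< k≤l)

    -- Serves twice: it keeps colour 1 among the crossing edges, and it makes the colours of every
    -- later bucket at least 2.
    first-block : ∀ {k} → 1 ≤ k → q ≤ length (below k)
    first-block {k} 1≤k = begin
      q                                         ≤⟨ q≤h² ⟩
      h * h                                     ≤⟨ length-crossing h 2h≤n ⟩
      length (filter (crossing? h) all-edges)   ≤⟨ length-⊆ (Unique.filter⁺ _ (edges-unique (complete n))) crossing-below ⟩
      length (below 1)                          ≤⟨ below-mono 1≤k ⟩
      length (below k)                          ∎
      where
      open ≤-Reasoning
      crossing-below : filter (crossing? h) all-edges ⊆ below 1
      crossing-below e∈ =
        let e∈E , cr = ∈-filter⁻ (crossing? h) {xs = all-edges} e∈
        in ∈-filter⁺ (λ e → key e <? 1) e∈E (s≤s (≤-reflexive (key-crossing cr)))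

    colour-1-inside : ∀ {u v} → toℕ u < toℕ v → colour u v ≡ 1 → toℕ u < h + h × toℕ v < h + h
    colour-1-inside {u} {v} u<v c≡1 = let u<h , _ , v<2h = key-0 key<1 in <-≤-trans u<h (m≤m+n h h) , v<2h
      where
      key<1 : key (u , v) < 1
      key<1 = ≰⇒> λ 1≤k → <⇒≱ (blockColour-1 (trans (sym (colour-< u<v)) c≡1))
        (≤-trans (first-block 1≤k) (rank-≥ (u , v)))

    module _ (n≤q : n ≤ q) (room : (h + h) * n + q < r * q) where

      -- As `w` is outside A, the edge is not crossing and `u` is its smaller end, so it lies in the
      -- bucket of `u`, with rank at least `p` and below `p + q`. By `room` these ranks stay within
      -- the full blocks, away from the leftover numbers.
      leaving-colours : ∀ {u} → toℕ u < h + h →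
        ∃[ c ] (2 ≤ c × suc c ≤ r ×
                (∀ {w} → h + h ≤ toℕ w → colour u w ≡ c ⊎ colour u w ≡ suc c))
      -- `suc (p / q)` is the colour of rank `p`, where `p` counts the edges before the bucket of
      -- `u`.
      leaving-colours {u} u<2h = suc (p / q) , s≤s (m≥n⇒m/n>0 (first-block (s≤s z≤n))) , c<r , two-colours
        where
        p = length (below (suc (toℕ u)))

        p≤ : p ≤ (h + h) * n
        p≤ = begin
          p                                                    ≤⟨ length-⊆ (Unique.filter⁺ _ (edges-unique (complete n))) below-⊆ ⟩
          length (cartesianProduct (initial n (h + h)) (allFin n))
                                                               ≡⟨ length-cartesianProduct (initial n (h + h)) (allFin n) ⟩
          length (initial n (h + h)) * length (allFin n)       ≤⟨ *-mono-≤ (length-initial n (h + h)) (≤-reflexive (length-tabulate {n = n} id)) ⟩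
          (h + h) * n                                          ∎
          where
          open ≤-Reasoning
          below-⊆ : below (suc (toℕ u)) ⊆ cartesianProduct (initial n (h + h)) (allFin n)
          below-⊆ {x , y} e∈ = ∈-cartesianProduct⁺
            (∈-initial (key-<-suc {x , y} u<2h (proj₂ (∈-filter⁻ (λ e → key e <? suc (toℕ u)) {xs = all-edges} e∈))))
            (∈-allFin y)

        q+p<rq : q + p < r * q
        q+p<rq = ≤-<-trans (≤-trans (≤-reflexive (+-comm q p)) (+-monoˡ-≤ q p≤)) room

        c<r : suc (suc (p / q)) ≤ r
        c<r = subst (_< r) ([m+n]/m≡1+n/m q p) (m<n*o⇒m/o<n q+p<rq)

        at-≤ : length (at (suc (toℕ u))) ≤ q
        at-≤ = begin
          length (at (suc (toℕ u)))     ≤⟨ length-⊆ (Unique.filter⁺ _ (edges-unique (complete n))) at-⊆ ⟩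
          length (map (u ,_) (allFin n)) ≡⟨ trans (length-map (u ,_) (allFin n)) (length-tabulate {n = n} id) ⟩
          n                             ≤⟨ n≤q ⟩
          q                             ∎
          where
          open ≤-Reasoning
          at-⊆ : at (suc (toℕ u)) ⊆ map (u ,_) (allFin n)
          at-⊆ {x , y} e∈
            with Fin.toℕ-injective (key-suc {x , y} (proj₂ (∈-filter⁻ (λ e → key e ≟ suc (toℕ u)) {xs = all-edges} e∈)))
          ... | refl = ∈-map⁺ (u ,_) (∈-allFin y)

        two-colours : ∀ {w} → h + h ≤ toℕ w → colour u w ≡ suc (p / q) ⊎ colour u w ≡ suc (suc (p / q))
        two-colours {w} 2h≤w = Sum.map colour≡ colour≡ (≤-suc-cases (/-monoˡ-≤ q p≤i) i/q≤)
          where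
          i = rank (u , w)
          u<w = <-≤-trans u<2h 2h≤w
          key≡ : key (u , w) ≡ suc (toℕ u)
          key≡ = key-¬crossing λ (_ , _ , w<2h) → <⇒≱ w<2h 2h≤w
          p≤i : p ≤ i
          p≤i = subst (λ k → length (below k) ≤ i) key≡ (rank-≥ (u , w))
          i<q+p : i < q + p
          i<q+p = begin-strict
            i                                ≡⟨⟩
            rank (u , w)                     <⟨ rank-< (∈-edges⁺ (complete n) u<w (<⇒≢ u<w ∘ cong toℕ)) ⟩
            length (below (suc (key (u , w)))) ≡⟨ cong (length ∘ below ∘ suc) key≡ ⟩
            length (below (2 + toℕ u))       ≡⟨ length-below-suc (suc (toℕ u)) ⟩
            p + length (at (suc (toℕ u)))    ≤⟨ +-monoʳ-≤ p at-≤ ⟩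
            p + q                            ≡⟨ +-comm p q ⟩
            q + p                            ∎
            where open ≤-Reasoning
          i/q≤ : i / q ≤ suc (p / q)
          i/q≤ = subst (i / q ≤_) ([m+n]/m≡1+n/m q p) (/-monoˡ-≤ q (<⇒≤ i<q+p))
          colour≡ : ∀ {k} → i / q ≡ k → colour u w ≡ suc k
          colour≡ refl = trans (colour-< u<w) (blockColour-< (<-trans i<q+p q+p<rq))
          ≤-suc-cases : ∀ {k l} → k ≤ l → l ≤ suc k → l ≡ k ⊎ l ≡ suc k
          ≤-suc-cases k≤l l≤1+k = Sum.map₁ (λ l<1+k → ≤-antisym (s≤s⁻¹ l<1+k) k≤l) (m≤n⇒m<n∨m≡n l≤1+k)

      -- Colour counts in a graph covered by few vertices of large degree

      module _ {ℓ D} (F : Graph n) (z : Fin (suc ℓ) → Fin n)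
               (cover : ∀ {u v} → Adj F u v → (∃[ i ] u ≡ z i) ⊎ (∃[ i ] v ≡ z i))
               (D≤degree : ∀ i → D ≤ degree F (z i)) where

        private
          N a : ℕ
          a = h + h
          N = suc ℓ * a + a * suc ℓ

          colour? : ∀ c → Decidable₁ {A = Pair} (λ (u , v) → colour u v ≡ c)
          colour? c (u , v) = colour u v ≟ c

          coloured : ℕ → List Pair
          coloured c = filter (colour? c) (edges F)

        -- An edge of colour 1 has both ends in A and one of them among the `z i`. Edges are ordered
        -- pairs and the covering end may be either component, hence the two products.
        count-1-≤ : count χ 1 F ≤ N
        count-1-≤ = begin
          count χ 1 F                         ≤⟨ length-⊆ (Unique.filter⁺ _ (edges-unique F)) coloured-⊆ ⟩
          length (cartesianProduct Z I ++ cartesianProduct I Z)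
                                              ≡⟨ length-++ (cartesianProduct Z I) ⟩
          length (cartesianProduct Z I) + length (cartesianProduct I Z)
                                              ≡⟨ cong₂ _+_ (length-cartesianProduct Z I) (length-cartesianProduct I Z) ⟩
          length Z * length I + length I * length Z
                                              ≤⟨ +-mono-≤ (*-mono-≤ Z≤ I≤) (*-mono-≤ I≤ Z≤) ⟩
          N                                   ∎
          where
          open ≤-Reasoning
          Z I : List (Fin n)
          Z = map z (allFin (suc ℓ))
          I = initial n a
          Z≤ : length Z ≤ suc ℓ
          Z≤ = ≤-reflexive (trans (length-map z (allFin (suc ℓ))) (length-tabulate {n = suc ℓ} id))
          I≤ : length I ≤ a
          I≤ = length-initial n a
          z∈Z : ∀ i → z i ∈ Z
          z∈Z i = ∈-map⁺ z (∈-allFin i)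
          coloured-⊆ : coloured 1 ⊆ cartesianProduct Z I ++ cartesianProduct I Z
          coloured-⊆ {u , v} e∈ with ∈-filter⁻ (colour? 1) {xs = edges F} e∈
          ... | e∈F , c≡1 with ∈-edges⁻ F e∈F
          ...   | u<v , uv with colour-1-inside u<v c≡1 | cover uv
          ...     | _ , v<a | inj₁ (i , refl) = ∈-++⁺ˡ (∈-cartesianProduct⁺ (z∈Z i) (∈-initial v<a))
          ...     | u<a , _ | inj₂ (i , refl) = ∈-++⁺ʳ (cartesianProduct Z I) (∈-cartesianProduct⁺ (∈-initial u<a) (z∈Z i))

        -- At most `a` neighbours of `z i` lie in A; the edges to all others have one of the two
        -- colours.
        D≤two-counts : ∀ {i c} → toℕ (z i) < a →
                       (∀ {w} → a ≤ toℕ w → colour (z i) w ≡ c ⊎ colour (z i) w ≡ suc c) →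
                       D ≤ a + (count χ c F + count χ (suc c) F)
        D≤two-counts {i} {c} z<a two = begin
          D                                  ≤⟨ D≤degree i ⟩
          length W                           ≤⟨ length-⊆ (Unique.filter⁺ _ (Unique.allFin⁺ n)) W-⊆ ⟩
          length (initial n a ++ outer)      ≡⟨ length-++ (initial n a) ⟩
          length (initial n a) + length outer ≤⟨ +-mono-≤ (length-initial n a) outer-≤ ⟩
          a + (count χ c F + count χ (suc c) F) ∎
          where
          open ≤-Reasoning
          W outer : List (Fin n)
          W = filter (adj? F (z i)) (allFin n)
          outer = filter (λ w → a ≤? toℕ w) W
          W-⊆ : W ⊆ initial n a ++ outer
          W-⊆ {w} w∈ with a ≤? toℕ w
          ... | yes a≤w = ∈-++⁺ʳ (initial n a) (∈-filter⁺ (λ w → a ≤? toℕ w) w∈ a≤w)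
          ... | no a≰w  = ∈-++⁺ˡ (∈-initial (≰⇒> a≰w))
          star-⊆ : map (z i ,_) outer ⊆ coloured c ++ coloured (suc c)
          star-⊆ e∈ with ∈-map⁻ (z i ,_) e∈
          ... | w , w∈ , refl with ∈-filter⁻ (λ w → a ≤? toℕ w) {xs = W} w∈
          ...   | w∈W , a≤w with ∈-edges⁺ F (<-≤-trans z<a a≤w) (proj₂ (∈-filter⁻ (adj? F (z i)) {xs = allFin n} w∈W)) | two a≤w
          ...     | e∈F | inj₁ c≡ = ∈-++⁺ˡ (∈-filter⁺ (colour? c) e∈F c≡)
          ...     | e∈F | inj₂ c≡ = ∈-++⁺ʳ (coloured c) (∈-filter⁺ (colour? (suc c)) e∈F c≡)
          outer-≤ : length outer ≤ count χ c F + count χ (suc c) F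
          outer-≤ = begin
            length outer                                    ≡⟨ length-map (z i ,_) outer ⟨
            length (map (z i ,_) outer)                     ≤⟨ length-⊆ (Unique.map⁺ (cong proj₂)
                                                                 (Unique.filter⁺ _ (Unique.filter⁺ _ (Unique.allFin⁺ n)))) star-⊆ ⟩
            length (coloured c ++ coloured (suc c))         ≡⟨ length-++ (coloured c) ⟩
            count χ c F + count χ (suc c) F                 ∎

        private
          centre-inside : ∀ {e} → e ∈ edges F → uncurry colour e ≡ 1 → ∃[ i ] toℕ (z i) < a
          centre-inside e∈F c≡1 with ∈-edges⁻ F e∈F
          ... | u<v , uv with colour-1-inside u<v c≡1 | cover uv
          ...   | u<a , _ | inj₁ (i , refl) = i , u<a
          ...   | _ , v<a | inj₂ (i , refl) = i , v<a

          some-edge : 0 < D → ∃[ e ] e ∈ edges F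
          some-edge 0<D with filter (adj? F (z zero)) (allFin n) in eq | <-≤-trans 0<D (D≤degree zero)
          ... | w ∷ _ | _ with proj₂ (∈-filter⁻ (adj? F (z zero)) {xs = allFin n} (subst (w ∈_) (sym eq) (here refl)))
          ...   | zw with Fin.<-cmp (z zero) w
          ...     | tri< z<w _ _  = _ , ∈-edges⁺ F z<w zw
          ...     | tri≈ _ z≡w _  = contradiction zw (Graph.irrefl F z≡w)
          ...     | tri> _ _ w<z  = _ , ∈-edges⁺ F w<z (Graph.symm F zw)

        -- If neither of the two colours at a covering vertex in A beat colour 1, each would occur
        -- at most `N` times and the degree would be at most `a + (N + N)`.
        colour-1-beaten : a + (N + N) < D → ∃[ c ] (2 ≤ c × c ≤ r × count χ 1 F < count χ c F)
        colour-1-beaten big with Fin.any? (λ i → toℕ (z i) <? a)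
        ... | yes (i , z<a) with leaving-colours z<a
        ...   | c , 2≤c , c<r , two with count χ 1 F <? count χ c F | count χ 1 F <? count χ (suc c) F
        ...     | yes 1<c | _       = c , 2≤c , <⇒≤ c<r , 1<c
        ...     | no _    | yes 1<c = suc c , m≤n⇒m≤1+n 2≤c , c<r , 1<c
        ...     | no 1≮c  | no 1≮c′ = contradiction big (≤⇒≯ (≤-trans (D≤two-counts {i} {c} z<a two)
          (+-monoʳ-≤ a (+-mono-≤ (≤-trans (≮⇒≥ 1≮c) count-1-≤) (≤-trans (≮⇒≥ 1≮c′) count-1-≤)))))
        -- With no covering vertex in A colour 1 is absent, so the colour of any edge wins with at
        -- least one occurrence.
        colour-1-beaten big | no outside with some-edge (≤-<-trans z≤n big)
        ... | e@(u , v) , e∈F = colour u v , ≤∧≢⇒< 1≤c (≢-sym c≢1) , c≤r ,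
                      <-≤-trans (s≤s none-1) (length-⊆ {xs = [ e ]} ([] ∷ []) e∈c)
          where
          in-range : 1 ≤ colour u v × colour u v ≤ r
          in-range = EdgeColouring.range χ (λ u≡v → <⇒≢ (proj₁ (∈-edges⁻ F e∈F)) (cong toℕ u≡v))
          1≤c = proj₁ in-range
          c≤r = proj₂ in-range
          c≢1 : colour u v ≢ 1
          c≢1 c≡1 = outside (centre-inside e∈F c≡1)
          none-1 : count χ 1 F ≤ 0
          none-1 = length-⊆ {ys = []} (Unique.filter⁺ _ (edges-unique F)) λ x∈ →
            let x∈F , c≡1 = ∈-filter⁻ (colour? 1) {xs = edges F} x∈
            in contradiction (centre-inside x∈F c≡1) outside
          e∈c : [ e ] ⊆ coloured (colour u v)
          e∈c (here refl) = ∈-filter⁺ (colour? (colour u v)) e∈F refl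

-- Sizes

module Parameters (ℓ r n h E : ℕ) .{{_ : NonZero r}} where

  t q : ℕ
  t = 4 * ((2 + ℓ) * (2 + ℓ))
  q = E / r

  16≤t : 16 ≤ t
  16≤t = *-monoʳ-≤ 4 {4} (*-mono-≤ {2} {2 + ℓ} {2} (m≤m+n 2 ℓ) (m≤m+n 2 ℓ))

  module Bounds (4t≤r : (4 * t) * (4 * t) ≤ r) (4r≤h : 4 * r ≤ h)
           (2th≤n : t * h + t * h ≤ n) (n≤4th : n ≤ 4 * (t * h))
           (E≤n² : E ≤ n * n) (th²≤E : (t * h) * (t * h) ≤ E) where

    open ≤-Reasoning

    1≤t : 1 ≤ t
    1≤t = ≤-trans (s≤s z≤n) 16≤t

    1≤r : 1 ≤ r
    1≤r = >-nonZero⁻¹ r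

    r≤h : r ≤ h
    r≤h = ≤-trans (m≤n*m r 4) 4r≤h

    1≤h : 1 ≤ h
    1≤h = ≤-trans 1≤r r≤h

    h≤th : h ≤ t * h
    h≤th = m≤n*m h t {{>-nonZero 1≤t}}

    2h≤n : h + h ≤ n
    2h≤n = ≤-trans (+-mono-≤ h≤th h≤th) 2th≤n

    -- The bound on `r` is spent here: `n * n` is at most `(4 * t) * (4 * t)` times `h * h`.
    q≤h² : q ≤ h * h
    q≤h² = *-cancelʳ-≤ q (h * h) r (begin
      q * r                          ≤⟨ m/n*n≤m E r ⟩
      E                              ≤⟨ E≤n² ⟩
      n * n                          ≤⟨ *-mono-≤ n≤4th n≤4th ⟩
      4 * (t * h) * (4 * (t * h))    ≡⟨ solve 2 (λ t h → con 4 :* (t :* h) :* (con 4 :* (t :* h)) :=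
                                          h :* h :* (con 4 :* t :* (con 4 :* t))) refl t h ⟩
      h * h * (4 * t * (4 * t))      ≤⟨ *-monoʳ-≤ (h * h) 4t≤r ⟩
      h * h * r                      ∎)

    -- Here `n` must be large against `r`: `4 * r` is at most `h`, so `n * r` is below the quadratic
    -- number of edges.
    n≤q : n ≤ q
    n≤q = begin
      n            ≡⟨ m*n/n≡m n r ⟨
      (n * r) / r  ≤⟨ /-monoˡ-≤ r nr≤E ⟩
      E / r        ∎
      where
      nr≤E : n * r ≤ E
      nr≤E = begin
        n * r              ≤⟨ *-monoˡ-≤ r n≤4th ⟩
        4 * (t * h) * r    ≡⟨ solve 2 (λ x r → con 4 :* x :* r := x :* (con 4 :* r)) refl (t * h) r ⟩
        (t * h) * (4 * r)  ≤⟨ *-monoʳ-≤ (t * h) (≤-trans 4r≤h h≤th) ⟩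
        (t * h) * (t * h)  ≤⟨ th²≤E ⟩
        E                  ∎

    room : (h + h) * n + q < r * q
    -- Adding `r` to both sides covers the remainder `E % r` by which `r * q` falls short of `E`.
    room = +-cancelʳ-< r _ _ (begin-strict
      (h + h) * n + q + r                        ≤⟨ +-mono-≤ (+-mono-≤ (*-monoʳ-≤ (h + h) n≤4th) q≤h²)
                                                      (≤-trans r≤h (m≤m*n h h {{>-nonZero 1≤h}})) ⟩
      (h + h) * (4 * (t * h)) + h * h + h * h    ≡⟨ solve 2 (λ t h → (h :+ h) :* (con 4 :* (t :* h)) :+ h :* h :+ h :* h :=
                                                      (con 8 :* t :+ con 2) :* (h :* h)) refl t h ⟩
      (8 * t + 2) * (h * h)                      ≤⟨ *-monoˡ-≤ (h * h) 8t+2≤t² ⟩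
      (t * t) * (h * h)                          ≡⟨ solve 2 (λ t h → t :* t :* (h :* h) := t :* h :* (t :* h)) refl t h ⟩
      (t * h) * (t * h)                          ≤⟨ th²≤E ⟩
      E                                          ≡⟨ m≡m%n+[m/n]*n E r ⟩
      E % r + E / r * r                          <⟨ +-monoˡ-< (E / r * r) (m%n<n E r) ⟩
      r + E / r * r                              ≡⟨ trans (+-comm r _) (cong (_+ r) (*-comm q r)) ⟩
      r * q + r                                  ∎)
      where
      8t+2≤t² : 8 * t + 2 ≤ t * t
      8t+2≤t² = begin
        8 * t + 2      ≤⟨ +-monoʳ-≤ (8 * t) (≤-trans (m≤m+n 2 14) (≤-trans 16≤t (m≤n*m t 8))) ⟩
        8 * t + 8 * t  ≡⟨ solve 1 (λ t → con 8 :* t :+ con 8 :* t := con 16 :* t) refl t ⟩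
        16 * t         ≤⟨ *-monoˡ-≤ t 16≤t ⟩
        t * t          ∎

    -- Were `d` at most `a + (N + N)`, the neighbourhoods counted in `order-≤` would cover fewer
    -- than `2 * t * h` vertices, which is at most `n`.
    few-edges : let a = h + h ; N = suc ℓ * a + a * suc ℓ in
                ∀ {d} → n ≤ suc ℓ * (2 + d) → a + (N + N) < d
    few-edges {d} n≤ = ≰⇒> λ d≤ → <-irrefl refl (begin-strict
      n                                          ≤⟨ n≤ ⟩
      suc ℓ * (2 + d)                            ≤⟨ *-monoʳ-≤ (suc ℓ) (+-mono-≤ (*-monoʳ-≤ 2 1≤h) d≤) ⟩
      suc ℓ * (2 * h + (a + (N + N)))            ≡⟨ solve 2 (λ ℓ h → let a = h :+ h ; m = con 1 :+ ℓ ; N = m :* a :+ a :* m in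
                                                      m :* (con 2 :* h :+ (a :+ (N :+ N))) :=
                                                      (con 8 :* ℓ :* ℓ :+ con 20 :* ℓ :+ con 12) :* h) refl ℓ h ⟩
      -- `12 * ℓ + 20` is the gap between this coefficient and 2t = 8(ℓ+2)².
      (8 * ℓ * ℓ + 20 * ℓ + 12) * h              <⟨ *-monoˡ-< h {{>-nonZero 1≤h}} (m<m+n (8 * ℓ * ℓ + 20 * ℓ + 12) {12 * ℓ + 20}
                                                      (≤-trans (s≤s z≤n) (m≤n+m 20 (12 * ℓ)))) ⟩
      (8 * ℓ * ℓ + 20 * ℓ + 12 + (12 * ℓ + 20)) * h
                                                 ≡⟨ solve 2 (λ ℓ h → let t = con 4 :* ((con 2 :+ ℓ) :* (con 2 :+ ℓ)) in
                                                      (con 8 :* ℓ :* ℓ :+ con 20 :* ℓ :+ con 12 :+ (con 12 :* ℓ :+ con 20)) :* h :=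
                                                      t :* h :+ t :* h) refl ℓ h ⟩
      t * h + t * h                              ≤⟨ 2th≤n ⟩
      n                                          ∎)
      where
      a = h + h
      N = suc ℓ * a + a * suc ℓ

  -- 4096 = 16² · 2⁴
  colours-suffice : ∀ k → ℓ ≡ suc k → 4096 ≤ k → k ^ 5 ≤ r → (4 * t) * (4 * t) ≤ r
  colours-suffice k refl 4096≤k k⁵≤r = begin
    (4 * t) * (4 * t)                          ≤⟨ *-mono-≤ 4t≤ 4t≤ ⟩
    64 * (k * k) * (64 * (k * k))              ≡⟨ solve 1 (λ k → con 64 :* (k :* k) :* (con 64 :* (k :* k)) :=
                                                    con 4096 :* (k :* (k :* (k :* (k :* con 1))))) refl k ⟩
    4096 * k ^ 4                               ≤⟨ *-monoˡ-≤ (k ^ 4) 4096≤k ⟩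
    k ^ 5                                      ≤⟨ k⁵≤r ⟩
    r                                          ∎
    where
    open ≤-Reasoning
    3+k≤2k : 3 + k ≤ 2 * k
    3+k≤2k = begin
      3 + k  ≤⟨ +-monoˡ-≤ k (≤-trans (≤ᵇ⇒≤ 3 4096 _) 4096≤k) ⟩
      k + k  ≡⟨ cong (k +_) (+-identityʳ k) ⟨
      2 * k  ∎
    4t≤ : 4 * t ≤ 64 * (k * k)
    4t≤ = begin
      4 * (4 * ((3 + k) * (3 + k)))  ≤⟨ *-monoʳ-≤ 4 (*-monoʳ-≤ 4 (*-mono-≤ 3+k≤2k 3+k≤2k)) ⟩
      4 * (4 * (2 * k * (2 * k)))    ≡⟨ solve 1 (λ k → con 4 :* (con 4 :* (con 2 :* k :* (con 2 :* k))) :=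
                                          con 64 :* (k :* k)) refl k ⟩
      64 * (k * k)                   ∎

-- Cuts

ℕ→ℚ : ℕ → ℚ
ℕ→ℚ m = ℤ.+ m ℚ./ 1

-- Normalising `m / 1` involves a gcd that does not compute for a variable `m`, so order and
-- products of naturals are transferred through unnormalised rationals.
toℚᵘ-ℕ→ℚ : ∀ m → toℚᵘ (ℕ→ℚ m) ℚᵘ.≃ mkℚᵘ (ℤ.+ m) 0
toℚᵘ-ℕ→ℚ m = ℚ.toℚᵘ-fromℚᵘ (mkℚᵘ (ℤ.+ m) 0)

ℕ→ℚ-cancel-< : ∀ {m n} → ℕ→ℚ m ℚ.< ℕ→ℚ n → m < n
ℕ→ℚ-cancel-< {m} {n} m<n = ℤ.drop‿+<+
  (subst₂ ℤ._<_ (ℤ.*-identityʳ (ℤ.+ m)) (ℤ.*-identityʳ (ℤ.+ n))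
    (ℚᵘ.drop-*<* (ℚᵘ.<-respˡ-≃ (toℚᵘ-ℕ→ℚ m) (ℚᵘ.<-respʳ-≃ (toℚᵘ-ℕ→ℚ n) (ℚ.toℚᵘ-mono-< m<n)))))

ℕ→ℚ-* : ∀ m n → ℕ→ℚ (m * n) ≡ ℕ→ℚ m ℚ.* ℕ→ℚ n
ℕ→ℚ-* m n = ℚ.toℚᵘ-injective (begin
  toℚᵘ (ℕ→ℚ (m * n))                     ≈⟨ toℚᵘ-ℕ→ℚ (m * n) ⟩
  mkℚᵘ (ℤ.+ (m * n)) 0                   ≈⟨ ℚᵘ.*≡* (cong (ℤ._* ℤ.+ 1) (ℤ.pos-* m n)) ⟩
  mkℚᵘ (ℤ.+ m) 0 ℚᵘ.* mkℚᵘ (ℤ.+ n) 0     ≈⟨ ℚᵘ.*-cong (toℚᵘ-ℕ→ℚ m) (toℚᵘ-ℕ→ℚ n) ⟨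
  toℚᵘ (ℕ→ℚ m) ℚᵘ.* toℚᵘ (ℕ→ℚ n)         ≈⟨ ℚ.toℚᵘ-homo-* (ℕ→ℚ m) (ℕ→ℚ n) ⟨
  toℚᵘ (ℕ→ℚ m ℚ.* ℕ→ℚ n)                 ∎)
  where open ℚᵘ.≃-Reasoning

ℕ→ℚ-^ : ∀ m k → ℕ→ℚ (m ^ k) ≡ ℕ→ℚ m ^ℚ k
ℕ→ℚ-^ m zero    = refl
ℕ→ℚ-^ m (suc k) = trans (ℕ→ℚ-* m (m ^ k)) (cong (ℕ→ℚ m ℚ.*_) (ℕ→ℚ-^ m k))

0<ℕ→ℚ : ∀ {m} → 0 < m → 0ℚ ℚ.< ℕ→ℚ m
0<ℕ→ℚ {suc m} _ = ℚ.positive⁻¹ _ {{ℚ.normalize-pos (suc m) 1}}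

0<* : ∀ {p q} → 0ℚ ℚ.< p → 0ℚ ℚ.< q → 0ℚ ℚ.< p ℚ.* q
0<* {p} {q} 0<p 0<q =
  ℚ.positive⁻¹ _ {{ℚ.pos*pos⇒pos p {{ℚ.positive 0<p}} q {{ℚ.positive 0<q}}}}

0<^ : ∀ {p} → 0ℚ ℚ.< p → ∀ k → 0ℚ ℚ.< p ^ℚ k
0<^ 0<p zero    = ℚ.positive⁻¹ 1ℚ
0<^ 0<p (suc k) = 0<* 0<p (0<^ 0<p k)

^-≤1 : ∀ {p} → 0ℚ ℚ.< p → p ℚ.< 1ℚ → ∀ k → p ^ℚ k ℚ.≤ 1ℚ
^-<1 : ∀ {p} → 0ℚ ℚ.< p → p ℚ.< 1ℚ → ∀ k → p ^ℚ suc k ℚ.< 1ℚ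
^-≤1 0<p p<1 zero    = ℚ.≤-refl
^-≤1 0<p p<1 (suc k) = ℚ.<⇒≤ (^-<1 0<p p<1 k)
^-<1 {p} 0<p p<1 k = ℚ.≤-<-trans
  (subst (p ℚ.* p ^ℚ k ℚ.≤_) (ℚ.*-identityʳ p)
    (ℚ.*-monoˡ-≤-nonNeg p {{ℚ.pos⇒nonNeg p {{ℚ.positive 0<p}}}} (^-≤1 0<p p<1 k)))
  p<1

-- This is x ≤ s for a positive rational s: the upper side of a cut that is given by its lower part.
Above : ℝ⁺ → ℚ → Set
Above x s = 0ℚ ℚ.< s × ¬ Below x s

below≤above : ∀ x {a s} → Below x a → Above x s → a ℚ.≤ s
below≤above x xa (0<s , ¬xs) = ℚ.≮⇒≥ λ s<a → ¬xs (ℝ⁺.downward x 0<s s<a xa)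

above-* : ∀ x y {s t} → Above x s → Above y t → Above (x *ᵣ y) (s ℚ.* t)
above-* x y {s} {t} x≤s@(0<s , _) y≤t@(0<t , _) = 0<* 0<s 0<t ,
  λ (_ , a , b , xa , yb , st<ab) → ℚ.<-irrefl refl (ℚ.<-≤-trans st<ab (ℚ.≤-trans
    (ℚ.*-monoʳ-≤-nonNeg b {{ℚ.pos⇒nonNeg b {{ℚ.positive (ℝ⁺.positive y yb)}}}} (below≤above x xa x≤s))
    (ℚ.*-monoˡ-≤-nonNeg s {{ℚ.pos⇒nonNeg s {{ℚ.positive 0<s}}}} (below≤above y yb y≤t))))

above-^ : ∀ x {s} → Above x s → ∀ k → Above (x ^ᵣ k) (s ^ℚ k)
above-^ x x≤s zero    = ℚ.positive⁻¹ 1ℚ , λ (_ , 1<1) → ℚ.<-irrefl refl 1<1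
above-^ x x≤s (suc k) = above-* x (x ^ᵣ k) x≤s (above-^ x x≤s k)

cut : ∀ c → 0ℚ ℚ.< c → ℝ⁺
cut c 0<c = record
  { Below     = λ q → 0ℚ ℚ.< q × q ℚ.< c
  ; positive  = proj₁
  ; inhabited = ℚ.<-dense 0<c
  ; bounded   = c , 0<c , λ (_ , c<c) → ℚ.<-irrefl refl c<c
  ; downward  = λ 0<p p<q (_ , q<c) → 0<p , ℚ.<-trans p<q q<c
  ; open-up   = λ (0<p , p<c) → let q , p<q , q<c = ℚ.<-dense p<c
                                in q , p<q , ℚ.<-trans 0<p p<q , q<c
  }

module _ (ε : ℝ⁺) (ℓ : ℕ) (⌈1/ε⌉≡ℓ : ⌈ 1/ᵣ ε ⌉≡ ℓ) where

  -- Such an `s` witnesses that `m` is in the lower part of 1/ε, and the ceiling exceeds all of that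
  -- part.
  <-ceiling : ∀ m {s} → 0 < m → Above ε s → ℕ→ℚ m ℚ.* s ℚ.< 1ℚ → m < ℓ
  <-ceiling m {s} 0<m (0<s , ¬εs) ms<1 =
    ℕ→ℚ-cancel-< (proj₁ ⌈1/ε⌉≡ℓ (0<ℕ→ℚ 0<m , s , 0<s , ¬εs , ms<1))

  -- If r < kʲ⁺¹ then 1/ε ≤ k, since a q in the lower part of 1/ε with q ≥ k
  -- would give kʲ⁺¹ < 1/εʲ⁺¹ ≤ r; hence ℓ ≤ k.
  ceiling-^-≤ : ∀ j r → 1/ᵣ (ε ^ᵣ suc j) ≤ℕ r → ∀ k → 0 < k → k < ℓ → k ^ suc j ≤ r
  ceiling-^-≤ j r 1/εʲ≤r k 0<k k<ℓ = ≮⇒≥ λ r<kʲ → <⇒≱ k<ℓ (proj₂ ⌈1/ε⌉≡ℓ k (1/ε≤k r<kʲ))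
    where
    1/ε≤k : r < k ^ suc j → 1/ᵣ ε ≤ℕ k
    1/ε≤k r<kʲ {q} (0<q , s , 0<s , ¬εs , qs<1) with q ℚ.<? ℕ→ℚ k
    ... | yes q<k = q<k
    ... | no q≮k  = contradiction r<kʲ (<⇒≯ (ℕ→ℚ-cancel-< (1/εʲ≤r
      ( 0<ℕ→ℚ (m^n>0 k {{>-nonZero 0<k}} (suc j)) , s ^ℚ suc j
      , proj₁ above , proj₂ above , subst (ℚ._< 1ℚ) power (^-<1 (0<* (0<ℕ→ℚ 0<k) 0<s) ks<1 j)))))
      where
      above = above-^ ε (0<s , ¬εs) (suc j)
      ks<1 : ℕ→ℚ k ℚ.* s ℚ.< 1ℚ
      ks<1 = ℚ.≤-<-trans (ℚ.*-monoʳ-≤-nonNeg s {{ℚ.pos⇒nonNeg s {{ℚ.positive 0<s}}}} (ℚ.≮⇒≥ q≮k)) qs<1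
      power : (ℕ→ℚ k ℚ.* s) ^ℚ suc j ≡ ℕ→ℚ (k ^ suc j) ℚ.* s ^ℚ suc j
      power = trans (^-distrib-* (ℕ→ℚ k) s (suc j)) (cong (ℚ._* s ^ℚ suc j) (sym (ℕ→ℚ-^ k (suc j))))

1/4096 : ℚ
1/4096 = ℤ.+ 1 ℚ./ 4096

-- Chosen to force ℓ > 4096, so that ℓ - 1 is at least the 4096 that `colours-suffice` asks for.
ε₀ : ℝ⁺
ε₀ = cut 1/4096 (ℚ.positive⁻¹ 1/4096)

4096<ceiling : ∀ ε ℓ → ε <ᵣ ε₀ → ⌈ 1/ᵣ ε ⌉≡ ℓ → 4096 < ℓ
4096<ceiling ε ℓ (q , ¬εq , 0<q , q<1/4096) ⌈1/ε⌉≡ℓ =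
  -- The product of 4096 and `1/4096` computes to `1ℚ`.
  <-ceiling ε ℓ ⌈1/ε⌉≡ℓ 4096 (s≤s z≤n) (0<q , ¬εq) (ℚ.*-monoʳ-<-pos (ℕ→ℚ 4096) q<1/4096)

-- Choice of the parameters

length-edges-≤ : ∀ {n} (G : Graph n) → length (edges G) ≤ n * n
length-edges-≤ {n} G = begin
  length (edges G)                                ≤⟨ length-filter _ (cartesianProduct (allFin n) (allFin n)) ⟩
  length (cartesianProduct (allFin n) (allFin n)) ≡⟨ length-cartesianProduct (allFin n) (allFin n) ⟩
  length (allFin n) * length (allFin n)           ≡⟨ cong₂ _*_ (length-tabulate {n = n} id) (length-tabulate {n = n} id) ⟩
  n * n                                           ∎
  where open ≤-Reasoning

-- As `h` is at least 1, the remainder is at most `h * (t + t)`, so rounding loses at most a factor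
-- 2.
quotient-bounds : ∀ t h n .{{_ : NonZero (t + t)}} → h ≡ n / (t + t) → 1 ≤ h →
                  t * h + t * h ≤ n × n ≤ 4 * (t * h)
quotient-bounds t h n refl 1≤h = lower , upper
  where
  open ≤-Reasoning
  T = t + t
  hT≡ : h * T ≡ t * h + t * h
  hT≡ = trans (*-comm h T) (*-distribʳ-+ h t t)
  lower : t * h + t * h ≤ n
  lower = begin
    t * h + t * h  ≡⟨ hT≡ ⟨
    h * T          ≤⟨ m/n*n≤m n T ⟩
    n              ∎
  upper : n ≤ 4 * (t * h)
  upper = begin
    n                                  ≡⟨ m≡m%n+[m/n]*n n T ⟩
    n % T + h * T                      ≤⟨ +-monoˡ-≤ (h * T) (≤-trans (m%n≤n n T) (m≤n*m T h {{>-nonZero 1≤h}})) ⟩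
    h * T + h * T                      ≡⟨ cong₂ _+_ hT≡ hT≡ ⟩
    t * h + t * h + (t * h + t * h)    ≡⟨ solve 1 (λ x → x :+ x :+ (x :+ x) := con 4 :* x) refl (t * h) ⟩
    4 * (t * h)                        ∎

module _ (ℓ r n h : ℕ) .{{_ : NonZero r}} where

  private
    E : ℕ
    E = length (edges (complete n))

  open Parameters ℓ r n h E

  module _ (4t≤r : (4 * t) * (4 * t) ≤ r) (4r≤h : 4 * r ≤ h)
           (2th≤n : t * h + t * h ≤ n) (n≤4th : n ≤ 4 * (t * h)) where

    private
      th²≤E : (t * h) * (t * h) ≤ E
      th²≤E = ≤-trans (length-crossing (t * h) 2th≤n) (length-filter (crossing? (t * h)) (edges (complete n)))

      module P = Bounds 4t≤r 4r≤h 2th≤n n≤4th (length-edges-≤ (complete n)) th²≤E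

      instance
        q≢0 : NonZero q
        q≢0 = >-nonZero (≤-trans P.1≤h (≤-trans (m≤m+n h h) (≤-trans P.2h≤n P.n≤q)))

      size : E ≡ r * q + E % r
      size = trans (m≡m%n+[m/n]*n E r) (trans (+-comm (E % r) _) (cong (_+ E % r) (*-comm q r)))

      module C = Construction n r h q (E % r) size (m%n<n E r)

    good-colouring :
      Σ[ χ ∈ EdgeColouring r (complete n) ]
        Balanced χ ×
        (∀ (H : Graph n) → IsCaterpillar ℓ H →
         ∀ (S : Subgraph (complete n)) → IsCopy H S →
         ∃[ c ] (2 ≤ c × c ≤ r ×
                 count χ 1 (Subgraph.graph S) < count χ c (Subgraph.graph S)))
    good-colouring = C.χ , C.balanced , λ H H-cat S copy →
      let open Copy H-cat copy in
      C.colour-1-beaten P.q≤h² P.2h≤n P.n≤q P.room (Subgraph.graph S)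
        copied-centre copied-edge-central
        (λ i → ≤-trans (P.few-edges (Caterpillar.order-≤ H-cat i)) (degree-≤ _))
        -- This fixes the degree bound `D` as `suc (a + (N + N))`.
        ≤-refl

proposition1p3 : ∃[ ε₀ ] ∀ (ε : ℝ⁺) → ε <ᵣ 1ᵣ → ε <ᵣ ε₀ →
    ∀ (r : ℕ) → 1/ᵣ (ε ^ᵣ 5) ≤ℕ r →
    ∀ (ℓ : ℕ) → ⌈ 1/ᵣ ε ⌉≡ ℓ →
    ∃[ N ] ∀ (n : ℕ) → N ≤ n →
    Σ[ χ ∈ EdgeColouring r (complete n) ]
    Balanced χ ×
    (∀ (H : Graph n) → IsCaterpillar ℓ H →
    ∀ (S : Subgraph (complete n)) → IsCopy H S →
    ∃[ c ] (2 ≤ c × c ≤ r ×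
    count χ 1 (Subgraph.graph S) < count χ c (Subgraph.graph S)))
proposition1p3 = ε₀ , λ ε _ ε<ε₀ r 1/ε⁵≤r ℓ ⌈1/ε⌉≡ℓ →
  colouring ε r 1/ε⁵≤r ℓ ⌈1/ε⌉≡ℓ (4096<ceiling ε ℓ ε<ε₀ ⌈1/ε⌉≡ℓ)
  where
  colouring : ∀ ε r → 1/ᵣ (ε ^ᵣ 5) ≤ℕ r → ∀ ℓ → ⌈ 1/ᵣ ε ⌉≡ ℓ → 4096 < ℓ → _
  -- The threshold on `n` is what makes `n / (t + t)` at least `4 * r`.
  colouring ε r 1/ε⁵≤r (suc k) ⌈1/ε⌉≡ℓ 4096<ℓ = (t + t) * (4 * r) , λ n N≤n →
    let h = n / (t + t)
        4r≤h : 4 * r ≤ h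
        4r≤h = begin
          4 * r                        ≡⟨ m*n/n≡m (4 * r) (t + t) ⟨
          4 * r * (t + t) / (t + t)    ≤⟨ /-monoˡ-≤ (t + t) (subst (_≤ n) (*-comm (t + t) (4 * r)) N≤n) ⟩
          h                            ∎
        2th≤n , n≤4th = quotient-bounds t h n refl (≤-trans (>-nonZero⁻¹ r) (≤-trans (m≤n*m r 4) 4r≤h))
    in good-colouring (suc k) r n h 4t≤r 4r≤h 2th≤n n≤4th
    where
    open ≤-Reasoning
    4096≤k : 4096 ≤ k
    4096≤k = s≤s⁻¹ 4096<ℓ
    0<k : 0 < k
    0<k = ≤-trans (s≤s z≤n) 4096≤k
    k⁵≤r : k ^ 5 ≤ r
    -- `k` = ℓ - 1 is the largest number that is certain to lie below 1/ε, so its fifth power is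
    -- what `r` is compared with.
    k⁵≤r = ceiling-^-≤ ε (suc k) ⌈1/ε⌉≡ℓ 4 r 1/ε⁵≤r k 0<k ≤-refl
    instance
      r≢0 : NonZero r
      r≢0 = >-nonZero (≤-trans (m^n>0 k {{>-nonZero 0<k}} 5) k⁵≤r)
    t : ℕ
    t = 4 * ((3 + k) * (3 + k))
    4t≤r : 4 * t * (4 * t) ≤ r
    4t≤r = Parameters.colours-suffice (suc k) r 0 0 0 k refl 4096≤k k⁵≤r
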